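{- For $n\ge1$ let $P_n(q)=C_n(q)/(q-1)^2$ (a palindromic polynomial with integer coefficients of degree $2n-2$), and write $$P_n(q)=a_{n,0}\,q^{n-1}+\sum_{i=1}^{n-1}a_{n,i}\,(q^{n+i-1}+q^{n-i-1})$$ with integers $a_{n,i}$. Then for $n\ge1$ and $0\le i\le n-1$, the integer $a_{n,i}$ is equal to the number of positive divisors $d$ of $n$ satisfying $$\frac{i+\sqrt{2n+i^2}}{2}<d\le i+\sqrt{2n+i^2}.$$
   Context: For each integer $n\ge1$, the Laurent polynomial $C_n(q)$ is defined by the identity of formal power series in $t$ $$1+\sum_{n\ge1}\frac{C_n(q)}{q^n}t^n=\prod_{i\ge1}\frac{(1-t^i)^2}{1-(q+q^{ -1})t^i+t^{2i}}.$$ It is known that $C_n(q)$ is a monic palindromic polynomial in $q$ with integer coefficients of degree $2n$ which is divisible by $(q-1)^2$; hence $P_n(q)=C_n(q)/(q-1)^2$ is a monic palindromic polynomial with integer coefficients of degree $2n-2$. -}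

module Defs where

open import Data.Nat as ℕ using (ℕ; zero; suc; _∸_; _<_; _≤_)
import Data.Nat.Properties as ℕP
open import Data.Nat.Divisibility using (_∣_; _∣?_)
open import Data.Integer as ℤ using (ℤ; +_; -[1+_])
open import Data.List using (List; []; _∷_; map; replicate; _++_; foldr; length; filter; upTo)
open import Data.Product using (_×_)
open import Relation.Nullary.Decidable using (_×-dec_)

module PolyOps {A : Set} (0A : A) (_+A_ _*A_ : A → A → A) where

  addP : List A → List A → List A
  addP []       ys       = ys
  addP xs       []       = xs
  addP (x ∷ xs) (y ∷ ys) = (x +A y) ∷ addP xs ys

  mulP : List A → List A → List A
  mulP []       ys = []
  mulP (x ∷ xs) ys = addP (map (x *A_) ys) (0A ∷ mulP xs ys)

  coeffP : List A → ℕ → A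
  coeffP []       _       = 0A
  coeffP (x ∷ xs) zero    = x
  coeffP (x ∷ xs) (suc k) = coeffP xs k

open PolyOps (+ 0) ℤ._+_ ℤ._*_ public
  renaming (addP to addZ; mulP to mulZ; coeffP to coeffZ)

-- Laurent polynomials in q over ℤ:  q^low * Σ_j cs_j q^j

record Laurent : Set where
  constructor mkL
  field
    low : ℤ
    cs  : List ℤ
open Laurent public

coeffL : Laurent → ℤ → ℤ
coeffL (mkL l c) k with k ℤ.- l
... | + j      = coeffZ c j
... | -[1+ _ ] = + 0

-- rewrite with a lower starting exponent m (m ≤ low assumed; only used so)
padL : ℤ → Laurent → List ℤ
padL m (mkL l c) = replicate (ℤ.∣ l ℤ.- m ∣) (+ 0) ++ c

_+L_ : Laurent → Laurent → Laurent
p +L r = mkL m (addZ (padL m p) (padL m r))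
  where m = low p ℤ.⊓ low r

_*L_ : Laurent → Laurent → Laurent
mkL l₁ c₁ *L mkL l₂ c₂ = mkL (l₁ ℤ.+ l₂) (mulZ c₁ c₂)

-L_ : Laurent → Laurent
-L mkL l c = mkL l (map ℤ.-_ c)

0L 1L : Laurent
0L = mkL (+ 0) []
1L = mkL (+ 0) (+ 1 ∷ [])

qPow : ℤ → Laurent
qPow k = mkL k (+ 1 ∷ [])

-- Polynomials in t with Laurent-polynomial coefficients (truncations of
-- formal power series in t).

open PolyOps 0L _+L_ _*L_ public
  renaming (addP to addT; mulP to mulT; coeffP to coeffT)

tPow : ℕ → List Laurent
tPow i = replicate i 0L ++ (1L ∷ [])

negT : List Laurent → List Laurent
negT = map -L_

powT : List Laurent → ℕ → List Laurent
powT f zero    = 1L ∷ []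
powT f (suc k) = mulT f (powT f k)

geomT : ℕ → List Laurent → List Laurent
geomT zero    f = 1L ∷ []
geomT (suc N) f = addT (geomT N f) (powT f (suc N))

-- X_i = (q + q⁻¹) t^i - t^{2i}, so that
-- 1 - (q+q⁻¹) t^i + t^{2i} = 1 - X_i  and  1/(1 - X_i) = Σ_k X_i^k.
Xfac : ℕ → List Laurent
Xfac i = addT (mulT ((qPow (+ 1) +L qPow (ℤ.- (+ 1))) ∷ []) (tPow i))
              (negT (tPow (i ℕ.+ i)))

-- (1 - t^i)^2 / (1 - (q+q⁻¹) t^i + t^{2i}), correct modulo t^{N+1}
-- (X_i has no constant term, so Σ_{k≤N} X_i^k ≡ 1/(1-X_i) mod t^{N+1}).
factorT : ℕ → ℕ → List Laurent
factorT N i = mulT (powT (addT (1L ∷ []) (negT (tPow i))) 2) (geomT N (Xfac i))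

prodT : ℕ → ℕ → List Laurent
prodT N zero    = 1L ∷ []
prodT N (suc M) = mulT (prodT N M) (factorT N (suc M))

-- Coefficient of t^n in the infinite product: factors with i > n are
-- ≡ 1 mod t^{n+1}, so only i = 1..n matter.
-- By definition  C_n(q)/q^n = [t^n] Π_{i≥1} ... , i.e. C_n = q^n · [t^n] Π.
C : ℕ → Laurent
C n = qPow (+ n) *L coeffT (prodT n n) n

-- P_n(q) = C_n(q)/(q-1)^2.  Since C_n is a polynomial divisible by
-- (q-1)^2 = (1-q)^2, the quotient is obtained by (exact) division as
-- power series in q:  P = C · (1-q)^{-2} = C · Σ_m (m+1) q^m, i.e.
--   [q^j] P_n = Σ_{k=0}^{j} (j-k+1) · [q^k] C_n.
sumTo : ℕ → (ℕ → ℤ) → ℤ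
sumTo zero    f = f 0
sumTo (suc j) f = sumTo j f ℤ.+ f (suc j)

coeffP : ℕ → ℕ → ℤ
coeffP n j = sumTo j (λ k → (+ (suc (j ∸ k))) ℤ.* coeffL (C n) (+ k))

a : ℕ → ℕ → ℤ
a n i = coeffP n ((n ∸ 1) ℕ.+ i)

-- The divisor condition, with s = √(2n + i²) (d, i, n naturals, d ≥ 1):
--   (i + s)/2 < d   ⇔  s < 2d - i  ⇔  2n + i² < (2d ∸ i)²
--                      (if 2d ≤ i both sides are false)
--   d ≤ i + s       ⇔  d - i ≤ s   ⇔  (d ∸ i)² ≤ 2n + i²
--                      (if d ≤ i both sides are true)
LowerOK : ℕ → ℕ → ℕ → Set
LowerOK n i d = 2 ℕ.* n ℕ.+ i ℕ.* i < ((2 ℕ.* d) ∸ i) ℕ.* ((2 ℕ.* d) ∸ i)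

UpperOK : ℕ → ℕ → ℕ → Set
UpperOK n i d = (d ∸ i) ℕ.* (d ∸ i) ≤ 2 ℕ.* n ℕ.+ i ℕ.* i

Good : ℕ → ℕ → ℕ → Set
Good n i d = (d ∣ n) × (LowerOK n i d × UpperOK n i d)

good? : ∀ n i d → Relation.Nullary.Decidable.Dec (Good n i d)
good? n i d = (d ∣? n) ×-dec ((_ ℕ.<? _) ×-dec (_ ℕ.≤? _))
  where import Relation.Nullary.Decidable

countDivs : ℕ → ℕ → ℕ
countDivs n i = length (filter (good? n i) (map suc (upTo n)))

{-# OPTIONS --safe #-}
module Submission where

-- With w = 2 - q - q⁻¹ = -(q-1)²/q and D_i = (1 - q tⁱ)(1 - q⁻¹ tⁱ) = (1 - tⁱ)² + w tⁱ, the finite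
-- product has the partial fraction expansion
--   ∏_{i≤M} (1-tⁱ)²/D_i = 1 + w Σ_{1≤k≤M} (-1)ᵏ t^(k(k+1)/2) r_{M,k} (1+tᵏ)/D_k,
--   r_{M,k} = (t)_M² / ((t)_{M-k} (t)_{M+k}),
-- proved by induction on M: the difference between two consecutive levels telescopes in k.
-- Modulo t^(M+1) the factors r_{M,k} disappear, and since
--   (1+tᵏ)/D_k = Σ_j t^(kj) Σ_{|a|≤j} qᵃ,
-- dividing by (q-1)² gives a_{n,i} = Σ_k (-1)^(k-1) #{ j ≥ i : k(k+1)/2 + k j = n }.
-- Put β(e) = #{ d : e d = n, 2d > e + 2i } and γ(f) = #{ l : f l = n, l > 2f + 2i }.  The k-th count is
-- β(k) for k odd, and γ(f) - β(2f) for k = 2f (l is even or odd), so a_{n,i} = Σ β - Σ γ.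
-- For d ∣ n and e = n/d, the lower bound on d says 2d > e + 2i and the upper one fails
-- iff d > 2e + 2i, so the divisors in question are also counted by Σ β - Σ γ.

open import Defs
open import Algebra.Bundles using (CommutativeRing)
import Algebra.Properties.AbelianGroup as AbelianGroupProperties
import Algebra.Properties.CommutativeSemiring.Exp as Exp
import Algebra.Properties.Ring as RingProperties
import Algebra.Properties.Semiring.Mult.TCOptimised as Mult
import Algebra.Solver.Ring as RingSolver
open import Algebra.Solver.Ring.AlmostCommutativeRing using (_-Raw-AlmostCommutative⟶_; fromCommutativeRing)
open import Data.Bool using (true; false; if_then_else_)
open import Data.Integer as ℤ using (ℤ; +_; -[1+_])
import Data.Integer.Properties as ℤP
open import Data.List using (List; []; _∷_; map; replicate; _++_; _∷ʳ_; length; filter; upTo)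
import Data.List.Properties as ListP
open import Data.Maybe using (Maybe; just; nothing)
open import Data.Nat as ℕ using (ℕ; zero; suc; _∸_; _≤_; _<_; z≤n; s≤s)
open import Data.Nat.Divisibility using (_∣?_; divides)
import Data.Nat.Properties as ℕP
open import Data.Nat.Tactic.RingSolver using (solve-∀)
open import Function using (_∘_)
open import Level using (0ℓ)
open import Relation.Binary.Definitions using (tri<; tri≈; tri>)
open import Relation.Binary.PropositionalEquality as ≡ using (_≡_; _≢_)
import Relation.Binary.Reasoning.Setoid as SetoidReasoning
open import Relation.Nullary using (Dec; yes; no; does; ¬_; contradiction)
open import Relation.Nullary.Decidable using (_×-dec_; dec-true; dec-false)

-- The coefficients of the expansion are residues in `q`. At `q` = tᵏ one has D_i = (1 - t^(i+k)) (1
-- - t^(i-k)) and w = -(1-tᵏ)²/tᵏ, which yields the sign, the triangular power, r_{M,k} and the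
-- factor 1+tᵏ. The constant 1 is the value at w = 0, where D_i = (1-tⁱ)². The list operations
-- defining `C` satisfy ring laws only up to representation (padding, trailing zeros, choice of
-- `low`). They are therefore interpreted in a commutative ring, where the ring solver applies. The
-- finite expansion holds in any commutative ring that supplies the inverses it mentions; nilpotence
-- of `t` supplies them, and makes the truncated series in the definition of `C` exact inverses. In
-- the concrete ring, elements are lists of monomials, and equality means agreement under all
-- functionals that ignore high powers of `t`, so no normal forms are needed. Division by (q-1)² is
-- never carried out in this ring. It is transposed to the functional that reads off a coefficient
-- of P_n, and so is multiplication by `w`; there the two cancel up to sign.

module Expansion {c ℓ} (R : CommutativeRing c ℓ) where
  open CommutativeRing R
  open RingProperties ring using (-‿distribˡ-*; -‿distribʳ-*; -0#≈0#; -‿involutive)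
  open AbelianGroupProperties +-abelianGroup using (⁻¹-∙-comm)
  open Mult semiring using (_×_; ×1-homo-*; ×-homo-+)
  open Exp commutativeSemiring using (_^_; ^-congˡ; ^-homo-*; ^-assocʳ; ^-distrib-*)
  open SetoidReasoning setoid

  -- The integers inside a commutative ring

  ι : ℤ → Carrier
  ι (+ n)    = n × 1#
  ι -[1+ n ] = - (suc n × 1#)

  ι-⊖ : ∀ m n → ι (m ℤ.⊖ n) ≈ m × 1# - n × 1#
  ι-⊖ m zero = begin
    m × 1#            ≈⟨ +-identityʳ _ ⟨
    m × 1# + 0#       ≈⟨ +-congˡ -0#≈0# ⟨
    m × 1# - 0#       ∎
  ι-⊖ zero (suc n) = sym (+-identityˡ _)
  ι-⊖ (suc m) (suc n) = begin
    ι (suc m ℤ.⊖ suc n)                     ≡⟨ ≡.cong ι (ℤP.[1+m]⊖[1+n]≡m⊖n m n) ⟩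
    ι (m ℤ.⊖ n)                             ≈⟨ ι-⊖ m n ⟩
    m × 1# - n × 1#                         ≈⟨ +-congʳ (+-identityˡ _) ⟨
    0# + m × 1# - n × 1#                    ≈⟨ +-congʳ (+-congʳ (-‿inverseʳ 1#)) ⟨
    1# - 1# + m × 1# - n × 1#               ≈⟨ +-congʳ (+-assoc _ _ _) ⟩
    1# + (- 1# + m × 1#) - n × 1#           ≈⟨ +-congʳ (+-congˡ (+-comm _ _)) ⟩
    1# + (m × 1# - 1#) - n × 1#             ≈⟨ +-congʳ (+-assoc _ _ _) ⟨
    1# + m × 1# - 1# - n × 1#               ≈⟨ +-assoc _ _ _ ⟩
    1# + m × 1# + (- 1# - n × 1#)           ≈⟨ +-congˡ (⁻¹-∙-comm _ _) ⟩
    1# + m × 1# - (1# + n × 1#)             ≈⟨ +-cong (×-homo-+ 1# 1 m) (-‿cong (×-homo-+ 1# 1 n)) ⟨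
    suc m × 1# - suc n × 1#                 ∎

  ι-neg : ∀ i → ι (ℤ.- i) ≈ - ι i
  ι-neg (+ zero)   = sym -0#≈0#
  ι-neg (+ suc n)  = refl
  ι-neg -[1+ n ]   = sym (-‿involutive _)

  ι-+ : ∀ i j → ι (i ℤ.+ j) ≈ ι i + ι j
  ι-+ (+ m)    (+ n)    = ×-homo-+ 1# m n
  ι-+ (+ m)    -[1+ n ] = ι-⊖ m (suc n)
  ι-+ -[1+ m ] (+ n)    = trans (ι-⊖ n (suc m)) (+-comm _ _)
  ι-+ -[1+ m ] -[1+ n ] = begin
    - (suc (suc (m ℕ.+ n)) × 1#)            ≡⟨ ≡.cong (λ k → - (suc k × 1#)) (ℕP.+-suc m n) ⟨
    - ((suc m ℕ.+ suc n) × 1#)              ≈⟨ -‿cong (×-homo-+ 1# (suc m) (suc n)) ⟩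
    - (suc m × 1# + suc n × 1#)             ≈⟨ ⁻¹-∙-comm _ _ ⟨
    - (suc m × 1#) - (suc n × 1#)           ∎

  ι-*⁺ : ∀ m j → ι (+ m ℤ.* j) ≈ ι (+ m) * ι j
  ι-*⁺ m (+ n) = begin
    ι (+ m ℤ.* + n)     ≡⟨ ≡.cong ι (ℤP.pos-* m n) ⟨
    (m ℕ.* n) × 1#      ≈⟨ ×1-homo-* m n ⟩
    m × 1# * (n × 1#)   ∎
  ι-*⁺ m -[1+ n ] = begin
    ι (+ m ℤ.* -[1+ n ])        ≡⟨ ≡.cong ι (ℤP.neg-distribʳ-* (+ m) (+ suc n)) ⟨
    ι (ℤ.- (+ m ℤ.* + suc n))   ≈⟨ ι-neg (+ m ℤ.* + suc n) ⟩
    - ι (+ m ℤ.* + suc n)       ≈⟨ -‿cong (ι-*⁺ m (+ suc n)) ⟩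
    - (m × 1# * (suc n × 1#))   ≈⟨ -‿distribʳ-* _ _ ⟩
    m × 1# * - (suc n × 1#)     ∎

  ι-* : ∀ i j → ι (i ℤ.* j) ≈ ι i * ι j
  ι-* (+ m)    j = ι-*⁺ m j
  ι-* -[1+ m ] j = begin
    ι (-[1+ m ] ℤ.* j)        ≡⟨ ≡.cong ι (ℤP.neg-distribˡ-* (+ suc m) j) ⟨
    ι (ℤ.- (+ suc m ℤ.* j))   ≈⟨ ι-neg (+ suc m ℤ.* j) ⟩
    - ι (+ suc m ℤ.* j)       ≈⟨ -‿cong (ι-*⁺ (suc m) j) ⟩
    - (suc m × 1# * ι j)      ≈⟨ -‿distribˡ-* _ _ ⟩
    - (suc m × 1#) * ι j      ∎

  -- Gives the ring solver integer constants, whose equality is decidable, over a ring whose own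
  -- equality need not be.
  ι-homomorphism : ℤ.+-*-rawRing -Raw-AlmostCommutative⟶ fromCommutativeRing R
  ι-homomorphism = record
    { ⟦_⟧    = ι
    ; +-homo = ι-+
    ; *-homo = ι-*
    ; -‿homo = ι-neg
    ; 0-homo = refl
    ; 1-homo = refl
    }

  ι-≟ : ∀ i j → Maybe (ι i ≈ ι j)
  ι-≟ i j with i ℤ.≟ j
  ... | yes ≡.refl = just refl
  ... | no _       = nothing

  open RingSolver ℤ.+-*-rawRing (fromCommutativeRing R) ι-homomorphism ι-≟
    using (solve; _:=_; _:+_; _:*_; _:-_; :-_; con)

  x≈y⇒x-y≈0 : ∀ {x y} → x ≈ y → x - y ≈ 0#
  x≈y⇒x-y≈0 {x} {y} x≈y = trans (+-congʳ x≈y) (-‿inverseʳ y)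

  -- Reduces an identity with hypotheses to one for the ring solver, one multiple of a hypothesis at a time.
  +-absorb : ∀ {x y u v} → u ≈ v → x ≈ y + (u - v) → x ≈ y
  +-absorb {x} {y} {u} {v} u≈v eq = begin
    x             ≈⟨ eq ⟩
    y + (u - v)   ≈⟨ +-congˡ (x≈y⇒x-y≈0 u≈v) ⟩
    y + 0#        ≈⟨ +-identityʳ y ⟩
    y             ∎

  -- The partial fraction expansion of the finite product

  module PartialFractions (q q⁻¹ t : Carrier) (qq⁻¹≈1 : q * q⁻¹ ≈ 1#) where

    z w : Carrier
    z = q + q⁻¹
    w = 1# + 1# - z

    p D : ℕ → Carrier
    p i = 1# - t ^ i
    D i = 1# - (z * t ^ i - t ^ i * t ^ i)

    -- e k = (-1)ᵏ t^(k(k+1)/2)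
    e : ℕ → Carrier
    e zero    = 1#
    e (suc k) = - (t ^ suc k * e k)

    geometric : Carrier → ℕ → Carrier
    geometric x zero    = 1#
    geometric x (suc N) = geometric x N + x ^ suc N

    geometric-sum : ∀ x N → (1# - x) * geometric x N ≈ 1# - x ^ suc N
    geometric-sum x zero = solve 1 (λ x → (con (+ 1) :- x) :* con (+ 1) := con (+ 1) :- x :* con (+ 1)) refl x
    geometric-sum x (suc N) = begin
      (1# - x) * (geometric x N + x ^ suc N)                    ≈⟨ distribˡ _ _ _ ⟩
      (1# - x) * geometric x N + (1# - x) * x ^ suc N           ≈⟨ +-congʳ (geometric-sum x N) ⟩
      1# - x ^ suc N + (1# - x) * x ^ suc N                     ≈⟨ solve 2 (λ x y → con (+ 1) :- y :+ (con (+ 1) :- x) :* y := con (+ 1) :- x :* y) refl x (x ^ suc N) ⟩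
      1# - x * x ^ suc N                                        ∎

    H : ℕ → Carrier
    H zero    = 1#
    H (suc j) = H j + (q ^ suc j + q⁻¹ ^ suc j)

    -- Multiplication by `q` and by `q⁻¹` shifts the window |a| ≤ j+1 one step up and one step down.
    -- The two shifted windows cover |a| ≤ j+2 once and their overlap |a| ≤ j a second time. This is
    -- the Chebyshev recurrence.
    z*H : ∀ j → z * H (suc j) ≈ H (suc (suc j)) + H j
    z*H zero = +-absorb (*-congˡ qq⁻¹≈1) (solve 2 (λ q r →
        (q :+ r) :* (con (+ 1) :+ (q :* con (+ 1) :+ r :* con (+ 1)))
        := con (+ 1) :+ (q :* con (+ 1) :+ r :* con (+ 1)) :+ (q :* (q :* con (+ 1)) :+ r :* (r :* con (+ 1))) :+ con (+ 1)
           :+ ((con (+ 2) :* (q :* r)) :- con (+ 2) :* con (+ 1))) refl q q⁻¹)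
    z*H (suc j) = +-absorb (z*H j) (+-absorb (*-congˡ {q ^ suc j + q⁻¹ ^ suc j} qq⁻¹≈1)
      (solve 5 (λ q r Q S h →
        let H₁ = h :+ (Q :+ S)
            H₂ = H₁ :+ (q :* Q :+ r :* S)
            H₃ = H₂ :+ (q :* (q :* Q) :+ r :* (r :* S))
        in (q :+ r) :* H₂ := H₃ :+ H₁ :+ ((q :+ r) :* H₁ :- (H₂ :+ h)) :+ ((Q :+ S) :* (q :* r) :- (Q :+ S) :* con (+ 1)))
        refl q q⁻¹ (q ^ suc j) (q⁻¹ ^ suc j) (H j)))

    W : ℕ → Carrier → Carrier
    W zero    x = 1#
    W (suc J) x = W J x + x ^ suc J * H (suc J)

    -- `W J x` truncates the power series of (1+x)/(1 - zx + x²). By `z*H` the interior powers of x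
    -- cancel; the two edge terms stay explicit because both contain x^(J+1), which nilpotence will
    -- kill.
    W-sum : ∀ J x → (1# - (z * x - x * x)) * W J x ≈ 1# + x - x ^ suc J * H (suc J) + x * x ^ suc J * H J
    W-sum zero x = solve 3 (λ q r x →
      (con (+ 1) :- ((q :+ r) :* x :- x :* x)) :* con (+ 1)
      := con (+ 1) :+ x :- x :* con (+ 1) :* (con (+ 1) :+ (q :* con (+ 1) :+ r :* con (+ 1))) :+ x :* (x :* con (+ 1)) :* con (+ 1))
      refl q q⁻¹ x
    W-sum (suc J) x = +-absorb (W-sum J x) (+-absorb (*-congˡ { - (x * x ^ suc J)} (z*H J))
      (solve 7 (λ z x y h₀ h₁ h₂ W →
         let D = con (+ 1) :- (z :* x :- x :* x) in
         D :* (W :+ y :* h₁)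
         := con (+ 1) :+ x :- x :* y :* h₂ :+ x :* (x :* y) :* h₁
            :+ (D :* W :- (con (+ 1) :+ x :- y :* h₁ :+ x :* y :* h₀))
            :+ ((:- (x :* y)) :* (z :* h₁) :- (:- (x :* y)) :* (h₂ :+ h₀)))
         refl z x (x ^ suc J) (H J) (H (suc J)) (H (suc (suc J))) (W J x)))

    module Recurrence (p⁻¹ V : ℕ → Carrier)
      (p*p⁻¹ : ∀ i → p (suc i) * p⁻¹ (suc i) ≈ 1#)
      (D*V : ∀ k → D (suc k) * V (suc k) ≈ 1# + t ^ suc k) where

      -- For k ≤ M, r M k = (t)_M² / ((t)_{M-k} (t)_{M+k}); it vanishes at k = M + 1, since then M ∸ M occurs.
      r : ℕ → ℕ → Carrier
      r M zero    = 1#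
      r M (suc k) = r M k * (p (M ∸ k) * p⁻¹ (M ℕ.+ suc k))

      S : ℕ → ℕ → Carrier
      S M zero    = 1#
      S M (suc K) = S M K + w * (e (suc K) * (r M (suc K) * V (suc K)))

      p*p⁻¹-+suc : ∀ M k → p (M ℕ.+ suc k) * p⁻¹ (M ℕ.+ suc k) ≈ 1#
      p*p⁻¹-+suc M k rewrite ℕP.+-suc M k = p*p⁻¹ (M ℕ.+ k)

      r-suc : ∀ M k → r M (suc k) * p (M ℕ.+ suc k) ≈ r M k * p (M ∸ k)
      r-suc M k = +-absorb (*-congˡ {r M k * p (M ∸ k)} (p*p⁻¹-+suc M k))
        (solve 4 (λ r a b c → r :* (a :* b) :* c := r :* a :+ (r :* a :* (c :* b) :- r :* a :* con (+ 1)))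
           refl (r M k) (p (M ∸ k)) (p⁻¹ (M ℕ.+ suc k)) (p (M ℕ.+ suc k)))

      -- The ratio of r_{M+1,k} to r_{M,k}, with denominators cleared: at k = M+1 the factor
      -- `p (suc M ∸ k)` is zero, and so is `r M k`, so the cleared form still holds there.
      r-step : ∀ M k → k ≤ suc M →
        r (suc M) k * (p (suc M ∸ k) * p (suc M ℕ.+ k)) ≈ p (suc M) * p (suc M) * r M k
      r-step M zero _ = begin
        1# * (p (suc M) * p (suc M ℕ.+ 0))   ≡⟨ ≡.cong (λ m → 1# * (p (suc M) * p m)) (ℕP.+-identityʳ (suc M)) ⟩
        1# * (p (suc M) * p (suc M))         ≈⟨ *-comm _ _ ⟩
        p (suc M) * p (suc M) * 1#           ∎
      r-step M (suc k) (s≤s k≤M) = begin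
        r (suc M) (suc k) * (p (M ∸ k) * p (suc M ℕ.+ suc k))                   ≈⟨ solve 3 (λ a b c → a :* (b :* c) := a :* c :* b) refl _ _ _ ⟩
        r (suc M) (suc k) * p (suc M ℕ.+ suc k) * p (M ∸ k)                     ≈⟨ *-congʳ (r-suc (suc M) k) ⟩
        -- The unit `p m * p⁻¹ m` is inserted so that `p m` completes the product required by the
        -- induction hypothesis while `p⁻¹ m` builds `r M (suc k)`.
        r (suc M) k * p (suc M ∸ k) * p (M ∸ k)                                 ≈⟨ *-congʳ (*-identityʳ _) ⟨
        r (suc M) k * p (suc M ∸ k) * 1# * p (M ∸ k)                            ≈⟨ *-congʳ (*-congˡ (p*p⁻¹-+suc M k)) ⟨
        r (suc M) k * p (suc M ∸ k) * (p m * p⁻¹ m) * p (M ∸ k)                 ≈⟨ solve 5 (λ a b c d e → a :* b :* (c :* d) :* e := a :* (b :* c) :* (e :* d)) refl _ _ _ _ _ ⟩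
        r (suc M) k * (p (suc M ∸ k) * p m) * (p (M ∸ k) * p⁻¹ m)               ≡⟨ ≡.cong (λ i → r (suc M) k * (p (suc M ∸ k) * p i) * (p (M ∸ k) * p⁻¹ m)) (ℕP.+-suc M k) ⟩
        r (suc M) k * (p (suc M ∸ k) * p (suc M ℕ.+ k)) * (p (M ∸ k) * p⁻¹ m)   ≈⟨ *-congʳ (r-step M k (ℕP.m≤n⇒m≤1+n k≤M)) ⟩
        p (suc M) * p (suc M) * r M k * (p (M ∸ k) * p⁻¹ m)                     ≈⟨ *-assoc _ _ _ ⟩
        p (suc M) * p (suc M) * r M (suc k)                                     ∎
        where m = M ℕ.+ suc k

      -- The telescoped form of the difference between two levels: the summands up to K leave a
      -- single boundary term. Its factor `p (suc M ∸ K)` vanishes at K = M+1, which is what closes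
      -- the recurrence in M.
      S-step : ∀ M K → K ≤ suc M →
        D (suc M) * S (suc M) K
          ≈ p (suc M) * p (suc M) * S M K
            + w * (t ^ suc M * (e K * (r (suc M) K * (p (suc M ∸ K) * p⁻¹ (suc M)))))
      S-step M zero _ = +-absorb (*-congˡ { - (w * t ^ suc M)} (p*p⁻¹ M))
        (solve 3 (λ z T v →
          let w = con (+ 1) :+ con (+ 1) :- z ; p = con (+ 1) :- T in
          (con (+ 1) :- (z :* T :- T :* T)) :* con (+ 1)
          := p :* p :* con (+ 1) :+ w :* (T :* (con (+ 1) :* (con (+ 1) :* (p :* v))))
             :+ ((:- (w :* T)) :* (p :* v) :- (:- (w :* T)) :* con (+ 1)))
          refl z (t ^ suc M) (p⁻¹ (suc M)))
      S-step M (suc K) (s≤s K≤M) =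
        -- `D-split` divides D_{M+1} by D_{K+1}. In the new summand, `r-step` turns the product part
        -- into the summand of level M, and `D*V` frees the remainder from its denominator. With
        -- `r-suc` and `p-split`, this remainder moves the old boundary term to the new one.
        +-absorb (S-step M K (ℕP.m≤n⇒m≤1+n K≤M))
        (+-absorb (*-congˡ {w * (e (suc K) * V (suc K))} (r-step M (suc K) (s≤s K≤M)))
        (+-absorb (*-congˡ {w * (e (suc K) * (r₁ * V (suc K)))} D-split)
        (+-absorb (*-congˡ {w * (e (suc K) * (r₁ * y))} (D*V K))
        (+-absorb (*-congˡ { - (w * (T * (e K * v)))} (r-suc (suc M) K))
        (+-absorb (*-congˡ {w * (e K * (r₁ * (1# + x)))} T≈x*y)
        (+-absorb (*-congˡ {w * (e K * (r₁ * (T * v)))} p-split)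
        (+-absorb (*-congˡ {w * (e K * (r₁ * (T * (1# + x))))} (p*p⁻¹ M))
        (solve 18 (λ w d dk e₀ r₀ r₁ rM pj pj' P pM v V S₀ S₁ T x y →
          let one = con (+ 1) ; e₁ = :- (x :* e₀) in
          d :* (S₁ :+ w :* (e₁ :* (r₁ :* V)))
          := pM :* pM :* (S₀ :+ w :* (e₁ :* (rM :* V))) :+ w :* (T :* (e₁ :* (r₁ :* (pj :* v))))
            :+ (d :* S₁ :- (pM :* pM :* S₀ :+ w :* (T :* (e₀ :* (r₀ :* (pj' :* v))))))
            :+ (w :* (e₁ :* V) :* (r₁ :* (pj :* P)) :- w :* (e₁ :* V) :* (pM :* pM :* rM))
            :+ (w :* (e₁ :* (r₁ :* V)) :* d :- w :* (e₁ :* (r₁ :* V)) :* (pj :* P :+ y :* dk))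
            :+ (w :* (e₁ :* (r₁ :* y)) :* (dk :* V) :- w :* (e₁ :* (r₁ :* y)) :* (one :+ x))
            :+ (:- (w :* (T :* (e₀ :* v))) :* (r₁ :* P) :- :- (w :* (T :* (e₀ :* v))) :* (r₀ :* pj'))
            :+ (w :* (e₀ :* (r₁ :* (one :+ x))) :* T :- w :* (e₀ :* (r₁ :* (one :+ x))) :* (x :* y))
            :+ (w :* (e₀ :* (r₁ :* (T :* v))) :* (P :+ x :* pj) :- w :* (e₀ :* (r₁ :* (T :* v))) :* ((one :+ x) :* pM))
            :+ (w :* (e₀ :* (r₁ :* (T :* (one :+ x)))) :* (pM :* v) :- w :* (e₀ :* (r₁ :* (T :* (one :+ x)))) :* one))
          refl w (D (suc M)) (D (suc K)) (e K) (r (suc M) K) r₁ (r M (suc K)) (p (M ∸ K)) (p (suc M ∸ K)) (p (suc M ℕ.+ suc K))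
            (p (suc M)) v (V (suc K)) (S M K) (S (suc M) K) T x y))))))))
        where
        T = t ^ suc M
        x = t ^ suc K
        y = t ^ (M ∸ K)
        v = p⁻¹ (suc M)
        r₁ = r (suc M) (suc K)
        T≈x*y : T ≈ x * y
        T≈x*y = begin
          t ^ suc M                       ≡⟨ ≡.cong (λ m → t ^ suc m) (ℕP.m+[n∸m]≡n K≤M) ⟨
          t ^ (suc K ℕ.+ (M ∸ K))         ≈⟨ ^-homo-* t (suc K) (M ∸ K) ⟩
          x * y                           ∎
        p-top : p (suc M ℕ.+ suc K) ≈ 1# - T * x
        p-top = +-congˡ (-‿cong (^-homo-* t (suc M) (suc K)))
        p-split : p (suc M ℕ.+ suc K) + x * p (M ∸ K) ≈ (1# + x) * p (suc M)
        p-split = +-absorb p-top (+-absorb T≈x*y (solve 4 (λ P T x y →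
          P :+ x :* (con (+ 1) :- y)
          := (con (+ 1) :+ x) :* (con (+ 1) :- T) :+ (P :- (con (+ 1) :- T :* x)) :+ (T :- x :* y))
          refl (p (suc M ℕ.+ suc K)) T x y))
        D-split : D (suc M) ≈ p (M ∸ K) * p (suc M ℕ.+ suc K) + y * D (suc K)
        D-split = +-absorb (*-congˡ { - p (M ∸ K)} p-top)
          (+-absorb (*-congˡ { - z + T + x} T≈x*y)
          (solve 5 (λ z P T x y →
          let D = λ x → con (+ 1) :- (z :* x :- x :* x) in
          D T := (con (+ 1) :- y) :* P :+ y :* D x
            :+ ((:- (con (+ 1) :- y)) :* P :- (:- (con (+ 1) :- y)) :* (con (+ 1) :- T :* x))
            :+ ((:- z :+ T :+ x) :* T :- (:- z :+ T :+ x) :* (x :* y)))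
          refl z (p (suc M ℕ.+ suc K)) T x y))

      p0≈0 : ∀ M → p (M ∸ M) ≈ 0#
      p0≈0 M = trans (reflexive (≡.cong p (ℕP.n∸n≡0 M))) (-‿inverseʳ 1#)

      S-recurrence : ∀ M → D (suc M) * S (suc M) (suc M) ≈ p (suc M) * p (suc M) * S M M
      S-recurrence M = +-absorb (S-step M (suc M) ℕP.≤-refl)
        -- Two leftovers carry the factor `p (M ∸ M)` and disappear together: the boundary term of
        -- `S-step`, and the extra summand k = M+1 in `S M (suc M)`.
        (+-absorb (*-congˡ {p (suc M) * p (suc M) * (w * (e (suc M) * (r M M * (p⁻¹ (M ℕ.+ suc M) * V (suc M)))))
                            + w * (t ^ suc M * (e (suc M) * (r (suc M) (suc M) * p⁻¹ (suc M))))} (p0≈0 M))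
        (solve 13 (λ d S₁ S₀ pM p₀ w e r₀ i V r₁ v T →
          d :* S₁ := pM :* pM :* S₀
            :+ (d :* S₁ :- (pM :* pM :* (S₀ :+ w :* (e :* (r₀ :* (p₀ :* i) :* V))) :+ w :* (T :* (e :* (r₁ :* (p₀ :* v))))))
            :+ ((pM :* pM :* (w :* (e :* (r₀ :* (i :* V)))) :+ w :* (T :* (e :* (r₁ :* v)))) :* p₀
                :- (pM :* pM :* (w :* (e :* (r₀ :* (i :* V)))) :+ w :* (T :* (e :* (r₁ :* v)))) :* con (+ 0)))
          refl (D (suc M)) (S (suc M) (suc M)) (S M M) (p (suc M)) (p (M ∸ M)) w (e (suc M)) (r M M)
            (p⁻¹ (M ℕ.+ suc M)) (V (suc M)) (r (suc M) (suc M)) (p⁻¹ (suc M)) (t ^ suc M)))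

  -- Evaluation of list polynomials and Laurent polynomials

  module PolyEval {A : Set} (0A : A) (_+A_ _*A_ : A → A → A) (h : A → Carrier)
    (h-0 : h 0A ≈ 0#)
    (h-+ : ∀ x y → h (x +A y) ≈ h x + h y)
    (h-* : ∀ x y → h (x *A y) ≈ h x * h y)
    (X : Carrier) where

    open PolyOps 0A _+A_ _*A_

    -- Instantiated with integer coefficients at `q`, and with `Laurent` coefficients at `t`. Only
    -- `h` must respect the operations, so that `A` itself may lack ring laws.
    eval : List A → Carrier
    eval []       = 0#
    eval (x ∷ xs) = h x + X * eval xs

    eval-add : ∀ xs ys → eval (addP xs ys) ≈ eval xs + eval ys
    eval-add []       ys       = sym (+-identityˡ _)
    eval-add (x ∷ xs) []       = sym (+-identityʳ _)
    eval-add (x ∷ xs) (y ∷ ys) = begin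
      h (x +A y) + X * eval (addP xs ys)             ≈⟨ +-cong (h-+ x y) (*-congˡ (eval-add xs ys)) ⟩
      h x + h y + X * (eval xs + eval ys)            ≈⟨ solve 5 (λ a b X c d → a :+ b :+ X :* (c :+ d) := a :+ X :* c :+ (b :+ X :* d)) refl _ _ _ _ _ ⟩
      h x + X * eval xs + (h y + X * eval ys)        ∎

    eval-scale : ∀ x ys → eval (map (x *A_) ys) ≈ h x * eval ys
    eval-scale x []       = sym (zeroʳ _)
    eval-scale x (y ∷ ys) = begin
      h (x *A y) + X * eval (map (x *A_) ys)         ≈⟨ +-cong (h-* x y) (*-congˡ (eval-scale x ys)) ⟩
      h x * h y + X * (h x * eval ys)                ≈⟨ solve 4 (λ a b X c → a :* b :+ X :* (a :* c) := a :* (b :+ X :* c)) refl _ _ _ _ ⟩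
      h x * (h y + X * eval ys)                      ∎

    eval-mul : ∀ xs ys → eval (mulP xs ys) ≈ eval xs * eval ys
    eval-mul []       ys = sym (zeroˡ _)
    eval-mul (x ∷ xs) ys = begin
      eval (addP (map (x *A_) ys) (0A ∷ mulP xs ys))      ≈⟨ eval-add (map (x *A_) ys) (0A ∷ mulP xs ys) ⟩
      eval (map (x *A_) ys) + (h 0A + X * eval (mulP xs ys)) ≈⟨ +-cong (eval-scale x ys) (+-cong h-0 (*-congˡ (eval-mul xs ys))) ⟩
      h x * eval ys + (0# + X * (eval xs * eval ys))      ≈⟨ solve 4 (λ a b X c → a :* c :+ (con (+ 0) :+ X :* (b :* c)) := (a :+ X :* b) :* c) refl _ _ _ _ ⟩
      (h x + X * eval xs) * eval ys                       ∎

    eval-negate : ∀ (neg : A → A) → (∀ x → h (neg x) ≈ - h x) → ∀ xs → eval (map neg xs) ≈ - eval xs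
    eval-negate neg h-neg []       = solve 0 (con (+ 0) := :- con (+ 0)) refl
    eval-negate neg h-neg (x ∷ xs) = begin
      h (neg x) + X * eval (map neg xs)   ≈⟨ +-cong (h-neg x) (*-congˡ (eval-negate neg h-neg xs)) ⟩
      - h x + X * - eval xs               ≈⟨ solve 3 (λ a X b → :- a :+ X :* :- b := :- (a :+ X :* b)) refl _ _ _ ⟩
      - (h x + X * eval xs)               ∎

    eval-shift : ∀ k xs → eval (replicate k 0A ++ xs) ≈ X ^ k * eval xs
    eval-shift zero    xs = sym (*-identityˡ _)
    eval-shift (suc k) xs = begin
      h 0A + X * eval (replicate k 0A ++ xs)   ≈⟨ +-cong h-0 (*-congˡ (eval-shift k xs)) ⟩
      0# + X * (X ^ k * eval xs)               ≈⟨ solve 3 (λ X Y e → con (+ 0) :+ X :* (Y :* e) := X :* Y :* e) refl _ _ _ ⟩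
      X ^ suc k * eval xs                      ∎

  module LaurentEval (q q⁻¹ : Carrier) (qq⁻¹≈1 : q * q⁻¹ ≈ 1#) where

    qᶻ : ℤ → Carrier
    qᶻ (+ n)    = q ^ n
    qᶻ -[1+ n ] = q⁻¹ ^ suc n

    qᶻ-⊖ : ∀ m n → qᶻ (m ℤ.⊖ n) ≈ q ^ m * q⁻¹ ^ n
    qᶻ-⊖ m zero = sym (*-identityʳ _)
    qᶻ-⊖ zero (suc n) = sym (*-identityˡ _)
    qᶻ-⊖ (suc m) (suc n) = begin
      qᶻ (suc m ℤ.⊖ suc n)                 ≡⟨ ≡.cong qᶻ (ℤP.[1+m]⊖[1+n]≡m⊖n m n) ⟩
      qᶻ (m ℤ.⊖ n)                         ≈⟨ qᶻ-⊖ m n ⟩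
      q ^ m * q⁻¹ ^ n                      ≈⟨ *-identityˡ _ ⟨
      1# * (q ^ m * q⁻¹ ^ n)               ≈⟨ *-congʳ qq⁻¹≈1 ⟨
      q * q⁻¹ * (q ^ m * q⁻¹ ^ n)          ≈⟨ solve 4 (λ a b c d → a :* b :* (c :* d) := a :* c :* (b :* d)) refl _ _ _ _ ⟩
      q ^ suc m * q⁻¹ ^ suc n              ∎

    qᶻ-+ : ∀ i j → qᶻ (i ℤ.+ j) ≈ qᶻ i * qᶻ j
    qᶻ-+ (+ m)    (+ n)    = ^-homo-* q m n
    qᶻ-+ (+ m)    -[1+ n ] = qᶻ-⊖ m (suc n)
    qᶻ-+ -[1+ m ] (+ n)    = trans (qᶻ-⊖ n (suc m)) (*-comm _ _)
    qᶻ-+ -[1+ m ] -[1+ n ] = begin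
      q⁻¹ ^ suc (suc (m ℕ.+ n))    ≡⟨ ≡.cong (λ k → q⁻¹ ^ suc k) (ℕP.+-suc m n) ⟨
      q⁻¹ ^ (suc m ℕ.+ suc n)      ≈⟨ ^-homo-* q⁻¹ (suc m) (suc n) ⟩
      q⁻¹ ^ suc m * q⁻¹ ^ suc n    ∎

    open PolyEval (+ 0) ℤ._+_ ℤ._*_ ι refl ι-+ ι-* q
      renaming (eval to evalZ; eval-add to evalZ-add; eval-mul to evalZ-mul;
                eval-negate to evalZ-negate; eval-shift to evalZ-shift)
      using () public

    evalL : Laurent → Carrier
    evalL (mkL l c) = qᶻ l * evalZ c

    -- `padL` pads by an absolute value, so its length is the true difference of exponents only for
    -- `m` below `low p`.
    evalL-pad : ∀ m p → m ℤ.≤ low p → qᶻ m * evalZ (padL m p) ≈ evalL p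
    evalL-pad m (mkL l c) m≤l = begin
      qᶻ m * evalZ (replicate d (+ 0) ++ c)   ≈⟨ *-congˡ (evalZ-shift d c) ⟩
      qᶻ m * (qᶻ (+ d) * evalZ c)             ≈⟨ *-assoc _ _ _ ⟨
      qᶻ m * qᶻ (+ d) * evalZ c               ≈⟨ *-congʳ (qᶻ-+ m (+ d)) ⟨
      qᶻ (m ℤ.+ + d) * evalZ c                ≡⟨ ≡.cong (λ i → qᶻ i * evalZ c) m+d≡l ⟩
      qᶻ l * evalZ c                          ∎
      where
      d = ℤ.∣ l ℤ.- m ∣
      m+d≡l : m ℤ.+ + d ≡ l
      m+d≡l = ≡.trans (≡.cong (λ i → m ℤ.+ i) (ℤP.0≤i⇒+∣i∣≡i (ℤP.i≤j⇒0≤j-i m≤l)))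
        (≡.trans (ℤP.+-comm m (l ℤ.- m)) (≡.trans (ℤP.+-assoc l (ℤ.- m) m)
          (≡.trans (≡.cong (λ i → l ℤ.+ i) (ℤP.+-inverseˡ m)) (ℤP.+-identityʳ l))))

    evalL-0 : evalL 0L ≈ 0#
    evalL-0 = zeroʳ _

    evalL-qPow : ∀ k → evalL (qPow k) ≈ qᶻ k
    evalL-qPow k = solve 2 (λ a q → a :* (con (+ 1) :+ q :* con (+ 0)) := a) refl _ _

    evalL-1 : evalL 1L ≈ 1#
    evalL-1 = evalL-qPow (+ 0)

    evalL-+ : ∀ p r → evalL (p +L r) ≈ evalL p + evalL r
    evalL-+ p r = begin
      qᶻ m * evalZ (addZ (padL m p) (padL m r))               ≈⟨ *-congˡ (evalZ-add (padL m p) (padL m r)) ⟩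
      qᶻ m * (evalZ (padL m p) + evalZ (padL m r))            ≈⟨ distribˡ _ _ _ ⟩
      qᶻ m * evalZ (padL m p) + qᶻ m * evalZ (padL m r)       ≈⟨ +-cong (evalL-pad m p (ℤP.i⊓j≤i (low p) (low r)))
                                                                        (evalL-pad m r (ℤP.i⊓j≤j (low p) (low r))) ⟩
      evalL p + evalL r                                       ∎
      where m = low p ℤ.⊓ low r

    evalL-* : ∀ p r → evalL (p *L r) ≈ evalL p * evalL r
    evalL-* (mkL l c) (mkL l′ c′) = begin
      qᶻ (l ℤ.+ l′) * evalZ (mulZ c c′)            ≈⟨ *-cong (qᶻ-+ l l′) (evalZ-mul c c′) ⟩
      qᶻ l * qᶻ l′ * (evalZ c * evalZ c′)          ≈⟨ solve 4 (λ a b c d → a :* b :* (c :* d) := a :* c :* (b :* d)) refl _ _ _ _ ⟩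
      qᶻ l * evalZ c * (qᶻ l′ * evalZ c′)          ∎

    evalL-neg : ∀ p → evalL (-L p) ≈ - evalL p
    evalL-neg (mkL l c) = begin
      qᶻ l * evalZ (map ℤ.-_ c)   ≈⟨ *-congˡ (evalZ-negate ℤ.-_ ι-neg c) ⟩
      qᶻ l * - evalZ c            ≈⟨ solve 2 (λ a b → a :* :- b := :- (a :* b)) refl _ _ ⟩
      - (qᶻ l * evalZ c)          ∎

  -- The product modulo t^(N+1)

  module ProductFormula
    (q q⁻¹ t : Carrier) (qq⁻¹≈1 : q * q⁻¹ ≈ 1#)
    (N : ℕ) (t-nilpotent : ∀ m → N < m → t ^ m ≈ 0#) where

    open LaurentEval q q⁻¹ qq⁻¹≈1
    open PartialFractions q q⁻¹ t qq⁻¹≈1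

    open PolyEval 0L _+L_ _*L_ evalL evalL-0 evalL-+ evalL-* t
      renaming (eval to evalT; eval-add to evalT-add; eval-mul to evalT-mul;
                eval-negate to evalT-negate; eval-shift to evalT-shift)
      using () public

    evalT-const : ∀ p → evalT (p ∷ []) ≈ evalL p
    evalT-const p = solve 2 (λ a t → a :+ t :* con (+ 0) := a) refl _ _

    evalT-1 : evalT (1L ∷ []) ≈ 1#
    evalT-1 = trans (evalT-const 1L) evalL-1

    evalT-tPow : ∀ i → evalT (tPow i) ≈ t ^ i
    evalT-tPow i = trans (evalT-shift i (1L ∷ [])) (trans (*-congˡ evalT-1) (*-identityʳ _))

    evalT-negT : ∀ f → evalT (negT f) ≈ - evalT f
    evalT-negT = evalT-negate -L_ evalL-neg

    evalT-powT : ∀ f k → evalT (powT f k) ≈ evalT f ^ k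
    evalT-powT f zero    = evalT-1
    evalT-powT f (suc k) = trans (evalT-mul f (powT f k)) (*-congˡ (evalT-powT f k))

    evalT-geomT : ∀ M f → evalT (geomT M f) ≈ geometric (evalT f) M
    evalT-geomT zero    f = evalT-1
    evalT-geomT (suc M) f = trans (evalT-add (geomT M f) (powT f (suc M)))
      (+-cong (evalT-geomT M f) (evalT-powT f (suc M)))

    evalT-Xfac : ∀ i → evalT (Xfac i) ≈ z * t ^ i - t ^ i * t ^ i
    evalT-Xfac i = begin
      evalT (Xfac i)                                              ≈⟨ evalT-add (mulT (zL ∷ []) (tPow i)) (negT (tPow (i ℕ.+ i))) ⟩
      evalT (mulT (zL ∷ []) (tPow i)) + evalT (negT (tPow (i ℕ.+ i)))  ≈⟨ +-cong (evalT-mul (zL ∷ []) (tPow i)) (evalT-negT (tPow (i ℕ.+ i))) ⟩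
      evalT (zL ∷ []) * evalT (tPow i) - evalT (tPow (i ℕ.+ i))   ≈⟨ +-cong (*-cong evalT-z (evalT-tPow i))
                                                                         (-‿cong (trans (evalT-tPow (i ℕ.+ i)) (^-homo-* t i i))) ⟩
      z * t ^ i - t ^ i * t ^ i                                   ∎
      where
      zL = qPow (+ 1) +L qPow (ℤ.- (+ 1))
      evalT-z : evalT (zL ∷ []) ≈ z
      evalT-z = begin
        evalT (zL ∷ [])                                        ≈⟨ evalT-const zL ⟩
        evalL zL                                               ≈⟨ evalL-+ (qPow (+ 1)) (qPow (ℤ.- (+ 1))) ⟩
        evalL (qPow (+ 1)) + evalL (qPow (ℤ.- (+ 1)))          ≈⟨ +-cong (evalL-qPow (+ 1)) (evalL-qPow (ℤ.- (+ 1))) ⟩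
        q * 1# + q⁻¹ * 1#                                      ≈⟨ +-cong (*-identityʳ q) (*-identityʳ q⁻¹) ⟩
        z                                                      ∎

    t^i-nilpotent : ∀ i → (t ^ suc i) ^ suc N ≈ 0#
    t^i-nilpotent i = trans (^-assocʳ t (suc i) (suc N)) (t-nilpotent _ (ℕP.m≤m+n (suc N) (i ℕ.* suc N)))

    -- The value of `Xfac (suc i)` is a multiple of t^(i+1), so its power N+1 is zero and the
    -- geometric sum used by `factorT` stops exactly.
    D*geometric : ∀ i → D (suc i) * geometric (evalT (Xfac (suc i))) N ≈ 1#
    D*geometric i = begin
      D (suc i) * geometric X N                  ≈⟨ *-congʳ (+-congˡ (-‿cong (evalT-Xfac (suc i)))) ⟨
      (1# - X) * geometric X N                   ≈⟨ geometric-sum X N ⟩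
      1# - X ^ suc N                             ≈⟨ +-congˡ (-‿cong X^suc-N) ⟩
      1# - 0#                                    ≈⟨ solve 0 (con (+ 1) :- con (+ 0) := con (+ 1)) refl ⟩
      1#                                         ∎
      where
      X = evalT (Xfac (suc i))
      y = t ^ suc i
      X^suc-N : X ^ suc N ≈ 0#
      X^suc-N = begin
        X ^ suc N                          ≈⟨ ^-congˡ (suc N) (evalT-Xfac (suc i)) ⟩
        (z * y - y * y) ^ suc N            ≈⟨ ^-congˡ (suc N) (solve 2 (λ z y → z :* y :- y :* y := y :* (z :- y)) refl z y) ⟩
        (y * (z - y)) ^ suc N              ≈⟨ ^-distrib-* y (z - y) (suc N) ⟩
        y ^ suc N * (z - y) ^ suc N        ≈⟨ *-congʳ (t^i-nilpotent i) ⟩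
        0# * (z - y) ^ suc N               ≈⟨ zeroˡ _ ⟩
        0#                                 ∎

    evalT-factorT : ∀ i → evalT (factorT N i) ≈ p i * p i * geometric (evalT (Xfac i)) N
    evalT-factorT i = begin
      evalT (factorT N i)                              ≈⟨ evalT-mul (powT f 2) (geomT N (Xfac i)) ⟩
      evalT (powT f 2) * evalT (geomT N (Xfac i))      ≈⟨ *-cong (evalT-powT f 2) (evalT-geomT N (Xfac i)) ⟩
      evalT f ^ 2 * geometric (evalT (Xfac i)) N       ≈⟨ *-congʳ (^-congˡ 2 evalT-f) ⟩
      p i ^ 2 * geometric (evalT (Xfac i)) N           ≈⟨ *-congʳ (*-congˡ (*-identityʳ _)) ⟩
      p i * p i * geometric (evalT (Xfac i)) N         ∎
      where
      f = addT (1L ∷ []) (negT (tPow i))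
      evalT-f : evalT f ≈ p i
      evalT-f = trans (evalT-add (1L ∷ []) (negT (tPow i)))
        (+-cong evalT-1 (trans (evalT-negT (tPow i)) (-‿cong (evalT-tPow i))))

    p⁻¹ V : ℕ → Carrier
    p⁻¹ i = geometric (t ^ i) N
    V k = W N (t ^ k)

    p*p⁻¹ : ∀ i → p (suc i) * p⁻¹ (suc i) ≈ 1#
    p*p⁻¹ i = begin
      p (suc i) * p⁻¹ (suc i)        ≈⟨ geometric-sum (t ^ suc i) N ⟩
      1# - (t ^ suc i) ^ suc N       ≈⟨ +-congˡ (-‿cong (t^i-nilpotent i)) ⟩
      1# - 0#                        ≈⟨ solve 0 (con (+ 1) :- con (+ 0) := con (+ 1)) refl ⟩
      1#                             ∎

    D*V : ∀ k → D (suc k) * V (suc k) ≈ 1# + t ^ suc k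
    D*V k = begin
      D (suc k) * W N x                                            ≈⟨ W-sum N x ⟩
      1# + x - x ^ suc N * H (suc N) + x * x ^ suc N * H N         ≈⟨ +-cong (+-congˡ (-‿cong (*-congʳ (t^i-nilpotent k)))) (*-congʳ (*-congˡ (t^i-nilpotent k))) ⟩
      1# + x - 0# * H (suc N) + x * 0# * H N                       ≈⟨ solve 3 (λ x a b → con (+ 1) :+ x :- con (+ 0) :* a :+ x :* con (+ 0) :* b := con (+ 1) :+ x) refl _ _ _ ⟩
      1# + x                                                       ∎
      where x = t ^ suc k

    open Recurrence p⁻¹ V p*p⁻¹ D*V

    evalT-prodT : ∀ M → evalT (prodT N M) ≈ S M M
    evalT-prodT zero = evalT-1
    evalT-prodT (suc M) = begin
      evalT (prodT N (suc M))                                ≈⟨ evalT-mul (prodT N M) (factorT N (suc M)) ⟩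
      evalT (prodT N M) * evalT (factorT N (suc M))          ≈⟨ *-cong (evalT-prodT M) (evalT-factorT (suc M)) ⟩
      S M M * (p (suc M) * p (suc M) * G)                    ≈⟨ solve 3 (λ s pp g → s :* (pp :* g) := pp :* s :* g) refl _ _ _ ⟩
      p (suc M) * p (suc M) * S M M * G                      ≈⟨ *-congʳ (S-recurrence M) ⟨
      D (suc M) * S (suc M) (suc M) * G                      ≈⟨ solve 3 (λ d s g → d :* s :* g := s :* (d :* g)) refl _ _ _ ⟩
      S (suc M) (suc M) * (D (suc M) * G)                    ≈⟨ *-congˡ (D*geometric M) ⟩
      S (suc M) (suc M) * 1#                                 ≈⟨ *-identityʳ _ ⟩
      S (suc M) (suc M)                                      ∎
      where G = geometric (evalT (Xfac (suc M))) N

    -- Each numerator factor of r differs from 1 by t^(N-k), which t^(k+1) annihilates; each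
    -- denominator has index above N and equals 1. The power of `t` needed for this is available
    -- inside `e k`.
    t^k*r : ∀ k → k ≤ N → t ^ k * r N k ≈ t ^ k
    t^k*r zero _ = *-identityʳ _
    t^k*r (suc k) k<N = begin
      t ^ suc k * (r N k * (p (N ∸ k) * p⁻¹ (N ℕ.+ suc k)))   ≈⟨ solve 5 (λ t x r p i → t :* x :* (r :* (p :* i)) := t :* (x :* r) :* (p :* i)) refl t (t ^ k) (r N k) (p (N ∸ k)) (p⁻¹ (N ℕ.+ suc k)) ⟩
      t * (t ^ k * r N k) * (p (N ∸ k) * p⁻¹ (N ℕ.+ suc k))   ≈⟨ *-cong (*-congˡ (t^k*r k k≤N)) (*-congˡ top) ⟩
      t ^ suc k * (p (N ∸ k) * 1#)                            ≈⟨ solve 2 (λ x y → x :* ((con (+ 1) :- y) :* con (+ 1)) := x :- x :* y) refl _ _ ⟩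
      t ^ suc k - t ^ suc k * t ^ (N ∸ k)                     ≈⟨ +-congˡ (-‿cong vanish) ⟩
      t ^ suc k - 0#                                          ≈⟨ solve 1 (λ x → x :- con (+ 0) := x) refl _ ⟩
      t ^ suc k                                               ∎
      where
      k≤N = ℕP.<⇒≤ k<N
      vanish : t ^ suc k * t ^ (N ∸ k) ≈ 0#
      vanish = trans (sym (^-homo-* t (suc k) (N ∸ k)))
        (t-nilpotent _ (ℕP.≤-reflexive (≡.cong suc (≡.sym (ℕP.m+[n∸m]≡n k≤N)))))
      m = N ℕ.+ suc k
      top : p⁻¹ m ≈ 1#
      top = begin
        p⁻¹ m               ≈⟨ solve 1 (λ i → i := (con (+ 1) :- con (+ 0)) :* i) refl _ ⟩
        (1# - 0#) * p⁻¹ m   ≈⟨ *-congʳ (+-congˡ (-‿cong (t-nilpotent m (ℕP.m<m+n N (s≤s z≤n))))) ⟨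
        p m * p⁻¹ m         ≈⟨ p*p⁻¹-+suc N k ⟩
        1#                  ∎

    Σ-eW : ℕ → Carrier
    Σ-eW zero    = 0#
    Σ-eW (suc K) = Σ-eW K + e (suc K) * W N (t ^ suc K)

    S-truncated : ∀ K → K ≤ N → S N K ≈ 1# + w * Σ-eW K
    S-truncated zero _ = solve 1 (λ w → con (+ 1) := con (+ 1) :+ w :* con (+ 0)) refl w
    S-truncated (suc K) K<N = begin
      S N K + w * (e (suc K) * (r N (suc K) * V (suc K)))                ≈⟨ +-cong (S-truncated K (ℕP.<⇒≤ K<N)) (*-congˡ e*r*V) ⟩
      1# + w * Σ-eW K + w * (e (suc K) * V (suc K))                      ≈⟨ solve 3 (λ w a b → con (+ 1) :+ w :* a :+ w :* b := con (+ 1) :+ w :* (a :+ b)) refl w _ _ ⟩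
      1# + w * Σ-eW (suc K)                                              ∎
      where
      e*r*V : e (suc K) * (r N (suc K) * V (suc K)) ≈ e (suc K) * V (suc K)
      e*r*V = begin
        - (t ^ suc K * e K) * (r N (suc K) * V (suc K))      ≈⟨ solve 4 (λ x e r v → :- (x :* e) :* (r :* v) := :- (x :* r :* e) :* v) refl _ _ _ _ ⟩
        - (t ^ suc K * r N (suc K) * e K) * V (suc K)        ≈⟨ *-congʳ (-‿cong (*-congʳ (t^k*r (suc K) K<N))) ⟩
        - (t ^ suc K * e K) * V (suc K)                      ∎

    prodT-formula : evalT (prodT N N) ≈ 1# + w * Σ-eW N
    prodT-formula = trans (evalT-prodT N) (S-truncated N ℕP.≤-refl)

    -- `w` stays attached to each `H j`, since it will be evaluated there as a second difference.
    Σ-tH : ℕ → ℕ → Carrier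
    Σ-tH k zero    = e k * (t ^ (k ℕ.* 0) * (w * H 0))
    Σ-tH k (suc J) = Σ-tH k J + e k * (t ^ (k ℕ.* suc J) * (w * H (suc J)))

    Σ-eH : ℕ → Carrier
    Σ-eH zero    = 0#
    Σ-eH (suc K) = Σ-eH K + Σ-tH (suc K) N

    w*e*W : ∀ k J → w * (e k * W J (t ^ k)) ≈ Σ-tH k J
    w*e*W k zero = begin
      w * (e k * 1#)                      ≈⟨ solve 2 (λ w e → w :* (e :* con (+ 1)) := e :* (con (+ 1) :* (w :* con (+ 1)))) refl w (e k) ⟩
      e k * (1# * (w * 1#))               ≡⟨ ≡.cong (λ m → e k * (t ^ m * (w * 1#))) (ℕP.*-zeroʳ k) ⟨
      e k * (t ^ (k ℕ.* 0) * (w * 1#))    ∎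
    w*e*W k (suc J) = begin
      w * (e k * (W J x + x ^ suc J * H (suc J)))                    ≈⟨ solve 5 (λ w e W x h → w :* (e :* (W :+ x :* h)) := w :* (e :* W) :+ e :* (x :* (w :* h))) refl w (e k) (W J x) (x ^ suc J) (H (suc J)) ⟩
      w * (e k * W J x) + e k * (x ^ suc J * (w * H (suc J)))        ≈⟨ +-cong (w*e*W k J) (*-congˡ (*-congʳ (^-assocʳ t k (suc J)))) ⟩
      Σ-tH k (suc J)                                                 ∎
      where x = t ^ k

    w*Σ-eW : ∀ K → w * Σ-eW K ≈ Σ-eH K
    w*Σ-eW zero    = zeroʳ w
    w*Σ-eW (suc K) = trans (distribˡ w _ _) (+-cong (w*Σ-eW K) (w*e*W (suc K) N))

    prodT-expansion : evalT (prodT N N) ≈ 1# + Σ-eH N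
    prodT-expansion = trans prodT-formula (+-congˡ (w*Σ-eW N))

-- The ring of truncated Laurent sums

open import Data.Integer.Solver using (module +-*-Solver)
open +-*-Solver using (solve; _:=_; _:+_; _:*_; :-_; con)
open import Data.Product using (_×_; _,_; proj₂)
open ≡ using (refl; sym; trans; cong; cong₂)

-- The term (c , a , b) stands for c qᵃ tᵇ.
Sum : Set
Sum = List (ℤ × ℤ × ℕ)

⟦_⟧ : Sum → (ℤ → ℕ → ℤ) → ℤ
⟦ [] ⟧              φ = + 0
⟦ (c , a , b) ∷ x ⟧ φ = c ℤ.* φ a b ℤ.+ ⟦ x ⟧ φ

_⊕_ : (ℤ → ℕ → ℤ) → (ℤ → ℕ → ℤ) → ℤ → ℕ → ℤ
(φ ⊕ ψ) a b = φ a b ℤ.+ ψ a b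

shift : ℤ → ℕ → (ℤ → ℕ → ℤ) → ℤ → ℕ → ℤ
shift a b φ a′ b′ = φ (a ℤ.+ a′) (b ℕ.+ b′)

scaleShift : ℤ → ℤ → ℕ → Sum → Sum
scaleShift c a b = map λ (c′ , a′ , b′) → c ℤ.* c′ , a ℤ.+ a′ , b ℕ.+ b′

_⊗_ : Sum → Sum → Sum
[]                ⊗ y = []
((c , a , b) ∷ x) ⊗ y = scaleShift c a b y ++ (x ⊗ y)

⊖_ : Sum → Sum
⊖_ = map λ (c , a , b) → ℤ.- c , a , b

one : Sum
one = (+ 1 , + 0 , 0) ∷ []

⟦⟧-cong : ∀ x {φ ψ} → (∀ a b → φ a b ≡ ψ a b) → ⟦ x ⟧ φ ≡ ⟦ x ⟧ ψ
⟦⟧-cong []                eq = refl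
⟦⟧-cong ((c , a , b) ∷ x) eq = cong₂ ℤ._+_ (cong (c ℤ.*_) (eq a b)) (⟦⟧-cong x eq)

⟦⟧-zero : ∀ x → ⟦ x ⟧ (λ _ _ → + 0) ≡ + 0
⟦⟧-zero []                = refl
⟦⟧-zero ((c , a , b) ∷ x) = cong₂ ℤ._+_ (ℤP.*-zeroʳ c) (⟦⟧-zero x)

⟦⟧-⊕ : ∀ x φ ψ → ⟦ x ⟧ (φ ⊕ ψ) ≡ ⟦ x ⟧ φ ℤ.+ ⟦ x ⟧ ψ
⟦⟧-⊕ []                φ ψ = refl
⟦⟧-⊕ ((c , a , b) ∷ x) φ ψ = trans (cong (λ s → c ℤ.* (φ a b ℤ.+ ψ a b) ℤ.+ s) (⟦⟧-⊕ x φ ψ))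
  (solve 5 (λ c f g h k → c :* (f :+ g) :+ (h :+ k) := c :* f :+ h :+ (c :* g :+ k)) refl c (φ a b) (ψ a b) (⟦ x ⟧ φ) (⟦ x ⟧ ψ))

⟦⟧-scale : ∀ x k φ → ⟦ x ⟧ (λ a b → k ℤ.* φ a b) ≡ k ℤ.* ⟦ x ⟧ φ
⟦⟧-scale []                k φ = sym (ℤP.*-zeroʳ k)
⟦⟧-scale ((c , a , b) ∷ x) k φ = trans (cong (λ s → c ℤ.* (k ℤ.* φ a b) ℤ.+ s) (⟦⟧-scale x k φ))
  (solve 4 (λ c k f h → c :* (k :* f) :+ k :* h := k :* (c :* f :+ h)) refl c k (φ a b) (⟦ x ⟧ φ))

⟦⟧-++ : ∀ x y φ → ⟦ x ++ y ⟧ φ ≡ ⟦ x ⟧ φ ℤ.+ ⟦ y ⟧ φ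
⟦⟧-++ []                y φ = sym (ℤP.+-identityˡ _)
⟦⟧-++ ((c , a , b) ∷ x) y φ = trans (cong (λ s → c ℤ.* φ a b ℤ.+ s) (⟦⟧-++ x y φ)) (sym (ℤP.+-assoc (c ℤ.* φ a b) _ _))

⟦⟧-⊖ : ∀ x φ → ⟦ ⊖ x ⟧ φ ≡ ℤ.- ⟦ x ⟧ φ
⟦⟧-⊖ []                φ = refl
⟦⟧-⊖ ((c , a , b) ∷ x) φ = trans (cong (λ s → ℤ.- c ℤ.* φ a b ℤ.+ s) (⟦⟧-⊖ x φ))
  (solve 3 (λ c f h → :- c :* f :+ :- h := :- (c :* f :+ h)) refl c (φ a b) (⟦ x ⟧ φ))

⟦⟧-scaleShift : ∀ c a b y φ → ⟦ scaleShift c a b y ⟧ φ ≡ c ℤ.* ⟦ y ⟧ (shift a b φ)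
⟦⟧-scaleShift c a b []                   φ = sym (ℤP.*-zeroʳ c)
⟦⟧-scaleShift c a b ((c′ , a′ , b′) ∷ y) φ = trans
  (cong (λ s → c ℤ.* c′ ℤ.* φ (a ℤ.+ a′) (b ℕ.+ b′) ℤ.+ s) (⟦⟧-scaleShift c a b y φ))
  (solve 4 (λ c c′ f h → c :* c′ :* f :+ c :* h := c :* (c′ :* f :+ h)) refl c c′ (φ (a ℤ.+ a′) (b ℕ.+ b′)) (⟦ y ⟧ (shift a b φ)))

-- A product acts as an iterated functional. The ring laws for `_⊗_` thereby reduce to laws for
-- exponents and to interchanging finite sums.
⟦⟧-⊗ : ∀ x y φ → ⟦ x ⊗ y ⟧ φ ≡ ⟦ x ⟧ (λ a b → ⟦ y ⟧ (shift a b φ))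
⟦⟧-⊗ []                y φ = refl
⟦⟧-⊗ ((c , a , b) ∷ x) y φ = trans (⟦⟧-++ (scaleShift c a b y) (x ⊗ y) φ)
  (cong₂ ℤ._+_ (⟦⟧-scaleShift c a b y φ) (⟦⟧-⊗ x y φ))

⟦⟧-swap : ∀ x y (Φ : ℤ → ℕ → ℤ → ℕ → ℤ) →
  ⟦ x ⟧ (λ a b → ⟦ y ⟧ (Φ a b)) ≡ ⟦ y ⟧ (λ a′ b′ → ⟦ x ⟧ (λ a b → Φ a b a′ b′))
⟦⟧-swap []                y Φ = sym (⟦⟧-zero y)
⟦⟧-swap ((c , a , b) ∷ x) y Φ = sym (trans
  (⟦⟧-⊕ y (λ a′ b′ → c ℤ.* Φ a b a′ b′) (λ a′ b′ → ⟦ x ⟧ (λ a b → Φ a b a′ b′)))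
  (cong₂ ℤ._+_ (⟦⟧-scale y c (Φ a b)) (sym (⟦⟧-swap x y Φ))))

⊗-comm : ∀ x y φ → ⟦ x ⊗ y ⟧ φ ≡ ⟦ y ⊗ x ⟧ φ
⊗-comm x y φ = begin
  ⟦ x ⊗ y ⟧ φ                                             ≡⟨ ⟦⟧-⊗ x y φ ⟩
  ⟦ x ⟧ (λ a b → ⟦ y ⟧ (shift a b φ))                     ≡⟨ ⟦⟧-swap x y (λ a b → shift a b φ) ⟩
  ⟦ y ⟧ (λ a b → ⟦ x ⟧ (λ a′ b′ → shift a′ b′ φ a b))     ≡⟨ ⟦⟧-cong y (λ a b → ⟦⟧-cong x (λ a′ b′ → cong₂ φ (ℤP.+-comm a′ a) (ℕP.+-comm b′ b))) ⟩
  ⟦ y ⟧ (λ a b → ⟦ x ⟧ (shift a b φ))                     ≡⟨ ⟦⟧-⊗ y x φ ⟨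
  ⟦ y ⊗ x ⟧ φ                                             ∎
  where open ≡.≡-Reasoning

⊗-assoc : ∀ x y z φ → ⟦ (x ⊗ y) ⊗ z ⟧ φ ≡ ⟦ x ⊗ (y ⊗ z) ⟧ φ
⊗-assoc x y z φ = begin
  ⟦ (x ⊗ y) ⊗ z ⟧ φ                                                         ≡⟨ ⟦⟧-⊗ (x ⊗ y) z φ ⟩
  ⟦ x ⊗ y ⟧ (λ a b → ⟦ z ⟧ (shift a b φ))                                   ≡⟨ ⟦⟧-⊗ x y _ ⟩
  ⟦ x ⟧ (λ a b → ⟦ y ⟧ (λ a′ b′ → ⟦ z ⟧ (shift (a ℤ.+ a′) (b ℕ.+ b′) φ)))   ≡⟨ ⟦⟧-cong x (λ a b → ⟦⟧-cong y (λ a′ b′ → ⟦⟧-cong z (λ a″ b″ →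
                                                                                 cong₂ φ (ℤP.+-assoc a a′ a″) (ℕP.+-assoc b b′ b″)))) ⟩
  ⟦ x ⟧ (λ a b → ⟦ y ⟧ (λ a′ b′ → ⟦ z ⟧ (shift a′ b′ (shift a b φ))))       ≡⟨ ⟦⟧-cong x (λ a b → ⟦⟧-⊗ y z (shift a b φ)) ⟨
  ⟦ x ⟧ (λ a b → ⟦ y ⊗ z ⟧ (shift a b φ))                                   ≡⟨ ⟦⟧-⊗ x (y ⊗ z) φ ⟨
  ⟦ x ⊗ (y ⊗ z) ⟧ φ                                                         ∎
  where open ≡.≡-Reasoning

⊗-distribʳ : ∀ x y z φ → ⟦ (y ++ z) ⊗ x ⟧ φ ≡ ⟦ (y ⊗ x) ++ (z ⊗ x) ⟧ φ
⊗-distribʳ x y z φ = begin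
  ⟦ (y ++ z) ⊗ x ⟧ φ                ≡⟨ ⟦⟧-⊗ (y ++ z) x φ ⟩
  ⟦ y ++ z ⟧ Ψ                      ≡⟨ ⟦⟧-++ y z Ψ ⟩
  ⟦ y ⟧ Ψ ℤ.+ ⟦ z ⟧ Ψ               ≡⟨ cong₂ ℤ._+_ (⟦⟧-⊗ y x φ) (⟦⟧-⊗ z x φ) ⟨
  ⟦ y ⊗ x ⟧ φ ℤ.+ ⟦ z ⊗ x ⟧ φ       ≡⟨ ⟦⟧-++ (y ⊗ x) (z ⊗ x) φ ⟨
  ⟦ (y ⊗ x) ++ (z ⊗ x) ⟧ φ          ∎
  where
  open ≡.≡-Reasoning
  Ψ = λ a b → ⟦ x ⟧ (shift a b φ)

⟦monomial⟧-⊗ : ∀ a b y φ → ⟦ ((+ 1 , a , b) ∷ []) ⊗ y ⟧ φ ≡ ⟦ y ⟧ (shift a b φ)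
⟦monomial⟧-⊗ a b y φ = begin
  ⟦ ((+ 1 , a , b) ∷ []) ⊗ y ⟧ φ           ≡⟨ ⟦⟧-⊗ ((+ 1 , a , b) ∷ []) y φ ⟩
  + 1 ℤ.* ⟦ y ⟧ (shift a b φ) ℤ.+ + 0      ≡⟨ ℤP.+-identityʳ _ ⟩
  + 1 ℤ.* ⟦ y ⟧ (shift a b φ)              ≡⟨ ℤP.*-identityˡ _ ⟩
  ⟦ y ⟧ (shift a b φ)                      ∎
  where open ≡.≡-Reasoning

⊗-identityˡ : ∀ y φ → ⟦ one ⊗ y ⟧ φ ≡ ⟦ y ⟧ φ
⊗-identityˡ y φ = trans (⟦monomial⟧-⊗ (+ 0) 0 y φ) (⟦⟧-cong y (λ a b → cong (λ a → φ a b) (ℤP.+-identityˡ a)))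

Vanishing : ℕ → (ℤ → ℕ → ℤ) → Set
Vanishing N φ = ∀ a b → N < b → φ a b ≡ + 0

-- Equality in ℤ[q, q⁻¹][t] / (t^(N+1)), tested on the functionals that kill t^b for b > N.
infix 4 _≈[_]_
record _≈[_]_ (x : Sum) (N : ℕ) (y : Sum) : Set where
  constructor tested
  field test : ∀ φ → Vanishing N φ → ⟦ x ⟧ φ ≡ ⟦ y ⟧ φ
open _≈[_]_ public

-- The powers of `t` above N span an ideal: a shift only raises the `t`-exponent. Hence shifted
-- functionals still vanish above N, and so does the functional that remains for x once y has been
-- summed out.
⊗-cong : ∀ {N x x′ y y′} → x ≈[ N ] x′ → y ≈[ N ] y′ → (x ⊗ y) ≈[ N ] (x′ ⊗ y′)
⊗-cong {N} {x} {x′} {y} {y′} x≈x′ y≈y′ = tested λ φ φ-vanishes → begin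
  ⟦ x ⊗ y ⟧ φ                                ≡⟨ ⟦⟧-⊗ x y φ ⟩
  ⟦ x ⟧ (λ a b → ⟦ y ⟧ (shift a b φ))        ≡⟨ ⟦⟧-cong x (λ a b → test y≈y′ (shift a b φ) λ a′ b′ N<b′ →
                                                  φ-vanishes _ _ (ℕP.≤-trans N<b′ (ℕP.m≤n+m b′ b))) ⟩
  ⟦ x ⟧ (λ a b → ⟦ y′ ⟧ (shift a b φ))       ≡⟨ test x≈x′ _ (λ a b N<b → trans
                                                  (⟦⟧-cong y′ λ a′ b′ → φ-vanishes _ _ (ℕP.≤-trans N<b (ℕP.m≤m+n b b′)))
                                                  (⟦⟧-zero y′)) ⟩
  ⟦ x′ ⟧ (λ a b → ⟦ y′ ⟧ (shift a b φ))      ≡⟨ ⟦⟧-⊗ x′ y′ φ ⟨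
  ⟦ x′ ⊗ y′ ⟧ φ                              ∎
  where open ≡.≡-Reasoning

truncatedRing : ℕ → CommutativeRing 0ℓ 0ℓ
truncatedRing N = record
  { Carrier = Sum
  ; _≈_ = λ x y → x ≈[ N ] y
  ; _+_ = _++_
  ; _*_ = _⊗_
  ; -_ = ⊖_
  ; 0# = []
  ; 1# = one
  ; isCommutativeRing = record
    { isRing = record
      { +-isAbelianGroup = record
        { isGroup = record
          { isMonoid = record
            { isSemigroup = record
              { isMagma = record
                { isEquivalence = record
                  { refl = tested λ φ _ → refl
                  ; sym = λ eq → tested λ φ φ-v → sym (test eq φ φ-v)
                  ; trans = λ eq eq′ → tested λ φ φ-v → trans (test eq φ φ-v) (test eq′ φ φ-v)
                  }
                ; ∙-cong = λ {x} {x′} {y} {y′} eq eq′ → tested λ φ φ-v → trans (⟦⟧-++ x y φ)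
                    (trans (cong₂ ℤ._+_ (test eq φ φ-v) (test eq′ φ φ-v)) (sym (⟦⟧-++ x′ y′ φ)))
                }
              ; assoc = λ x y z → tested λ φ _ → cong (λ u → ⟦ u ⟧ φ) (ListP.++-assoc x y z)
              }
            ; identity = (λ x → tested λ φ _ → refl)
                       , (λ x → tested λ φ _ → cong (λ u → ⟦ u ⟧ φ) (ListP.++-identityʳ x))
            }
          ; inverse = (λ x → tested λ φ _ → trans (⟦⟧-++ (⊖ x) x φ)
                        (trans (cong (ℤ._+ ⟦ x ⟧ φ) (⟦⟧-⊖ x φ)) (ℤP.+-inverseˡ (⟦ x ⟧ φ))))
                    , (λ x → tested λ φ _ → trans (⟦⟧-++ x (⊖ x) φ)
                        (trans (cong (λ s → ⟦ x ⟧ φ ℤ.+ s) (⟦⟧-⊖ x φ)) (ℤP.+-inverseʳ (⟦ x ⟧ φ))))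
          ; ⁻¹-cong = λ {x} {y} eq → tested λ φ φ-v → trans (⟦⟧-⊖ x φ)
              (trans (cong ℤ.-_ (test eq φ φ-v)) (sym (⟦⟧-⊖ y φ)))
          }
        ; comm = λ x y → tested λ φ _ → trans (⟦⟧-++ x y φ)
            (trans (ℤP.+-comm (⟦ x ⟧ φ) (⟦ y ⟧ φ)) (sym (⟦⟧-++ y x φ)))
        }
      ; *-cong = ⊗-cong
      ; *-assoc = λ x y z → tested λ φ _ → ⊗-assoc x y z φ
      ; *-identity = (λ x → tested λ φ _ → ⊗-identityˡ x φ)
                   , (λ x → tested λ φ _ → trans (⊗-comm x one φ) (⊗-identityˡ x φ))
      ; distrib = (λ x y z → tested λ φ _ → trans (⊗-comm x (y ++ z) φ)
                    (trans (⊗-distribʳ x y z φ) (trans (⟦⟧-++ (y ⊗ x) (z ⊗ x) φ)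
                    (trans (cong₂ ℤ._+_ (⊗-comm y x φ) (⊗-comm z x φ)) (sym (⟦⟧-++ (x ⊗ y) (x ⊗ z) φ))))))
                , (λ x y z → tested λ φ _ → ⊗-distribʳ x y z φ)
      }
    ; *-comm = λ x y → tested λ φ _ → ⊗-comm x y φ
    }
  }

-- Indicators and finite sums of functionals

χ : ∀ {P : Set} → Dec P → ℤ
χ P? = if does P? then + 1 else + 0

χ-true : ∀ {P : Set} (P? : Dec P) → P → χ P? ≡ + 1
χ-true P? p rewrite dec-true P? p = refl

χ-false : ∀ {P : Set} (P? : Dec P) → ¬ P → χ P? ≡ + 0
χ-false P? ¬p rewrite dec-false P? ¬p = refl

χ-cong : ∀ {P Q : Set} (P? : Dec P) (Q? : Dec Q) → (P → Q) → (Q → P) → χ P? ≡ χ Q?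
χ-cong (yes p) Q? to from = sym (χ-true Q? (to p))
χ-cong (no ¬p) Q? to from = sym (χ-false Q? (λ q → ¬p (from q)))

-- The second difference will be evaluated only for j < n, a bound that follows from the very
-- equation tested by the indicator; hence the premise may assume P.
χ-guarded-neg : ∀ {P : Set} (P? : Dec P) s {x y} → (P → x ≡ ℤ.- y) →
  (ℤ.- s) ℤ.* (χ P? ℤ.* x) ≡ s ℤ.* (χ P? ℤ.* y)
χ-guarded-neg (yes p) s {y = y} eq rewrite eq p =
  solve 2 (λ s y → :- s :* (con (+ 1) :* :- y) := s :* (con (+ 1) :* y)) refl s y
χ-guarded-neg (no _)  s {x} {y} _ = trans (ℤP.*-zeroʳ (ℤ.- s)) (sym (ℤP.*-zeroʳ s))

sumTo-cong : ∀ n {f g : ℕ → ℤ} → (∀ k → k ≤ n → f k ≡ g k) → sumTo n f ≡ sumTo n g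
sumTo-cong zero    eq = eq 0 z≤n
sumTo-cong (suc n) eq = cong₂ ℤ._+_ (sumTo-cong n (λ k k≤n → eq k (ℕP.m≤n⇒m≤1+n k≤n))) (eq (suc n) ℕP.≤-refl)

sumTo-⟦⟧ : ∀ n x (g : ℕ → ℤ) (φ : ℕ → ℤ → ℕ → ℤ) →
  sumTo n (λ k → g k ℤ.* ⟦ x ⟧ (φ k)) ≡ ⟦ x ⟧ (λ a b → sumTo n (λ k → g k ℤ.* φ k a b))
sumTo-⟦⟧ zero    x g φ = sym (⟦⟧-scale x (g 0) (φ 0))
sumTo-⟦⟧ (suc n) x g φ = trans
  (cong₂ ℤ._+_ (sumTo-⟦⟧ n x g φ) (sym (⟦⟧-scale x (g (suc n)) (φ (suc n)))))
  (sym (⟦⟧-⊕ x (λ a b → sumTo n (λ k → g k ℤ.* φ k a b)) (λ a b → g (suc n) ℤ.* φ (suc n) a b)))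

-- Reading coefficients of Laurent polynomials by functionals

δ : ℤ → ℤ → ℤ
δ k a = χ (a ℤ.≟ k)

pairing : List ℤ → ℤ → (ℤ → ℤ) → ℤ
pairing []      l ψ = + 0
pairing (x ∷ c) l ψ = x ℤ.* ψ l ℤ.+ pairing c (+ 1 ℤ.+ l) ψ

pairingL : Laurent → (ℤ → ℤ) → ℤ
pairingL (mkL l c) = pairing c l

pairing-cong : ∀ c l {ψ ψ′} → (∀ a → ψ a ≡ ψ′ a) → pairing c l ψ ≡ pairing c l ψ′
pairing-cong []      l eq = refl
pairing-cong (x ∷ c) l eq = cong₂ ℤ._+_ (cong (x ℤ.*_) (eq l)) (pairing-cong c (+ 1 ℤ.+ l) eq)

pairingL-cong : ∀ p {ψ ψ′} → (∀ a → ψ a ≡ ψ′ a) → pairingL p ψ ≡ pairingL p ψ′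
pairingL-cong (mkL l c) = pairing-cong c l

pairingL-zero : ∀ p → pairingL p (λ _ → + 0) ≡ + 0
pairingL-zero (mkL l c) = go c l
  where
  go : ∀ c l → pairing c l (λ _ → + 0) ≡ + 0
  go []      l = refl
  go (x ∷ c) l = cong₂ ℤ._+_ (ℤP.*-zeroʳ x) (go c (+ 1 ℤ.+ l))

coeffZᶻ : List ℤ → ℤ → ℤ
coeffZᶻ c (+ j)      = coeffZ c j
coeffZᶻ c -[1+ _ ]   = + 0

coeffL≡coeffZᶻ : ∀ l c k → coeffL (mkL l c) k ≡ coeffZᶻ c (k ℤ.- l)
coeffL≡coeffZᶻ l c k with k ℤ.- l
... | + j      = refl
... | -[1+ _ ] = refl

-- With the target written as an offset from `l`, one step along the list lowers `d` by one; a
-- negative offset lies before the list, where the coefficient is zero.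
pairing-δ : ∀ c l d → pairing c l (δ (l ℤ.+ d)) ≡ coeffZᶻ c d
pairing-δ []      l (+ j)    = refl
pairing-δ []      l -[1+ j ] = refl
pairing-δ (x ∷ c) l d = trans (cong₂ (λ u v → x ℤ.* u ℤ.+ pairing c (+ 1 ℤ.+ l) (δ v)) δ-shift l+d≡)
  (trans (cong (λ s → x ℤ.* δ d (+ 0) ℤ.+ s) (pairing-δ c (+ 1 ℤ.+ l) (-[1+ 0 ] ℤ.+ d))) (step d))
  where
  δ-shift : δ (l ℤ.+ d) l ≡ δ d (+ 0)
  δ-shift = χ-cong (l ℤ.≟ l ℤ.+ d) (+ 0 ℤ.≟ d)
    (λ eq → AbelianGroupProperties.∙-cancelˡ ℤP.+-0-abelianGroup l (+ 0) d (trans (ℤP.+-identityʳ l) eq))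
    (λ eq → trans (sym (ℤP.+-identityʳ l)) (cong (λ d → l ℤ.+ d) eq))
  l+d≡ : l ℤ.+ d ≡ + 1 ℤ.+ l ℤ.+ (-[1+ 0 ] ℤ.+ d)
  l+d≡ = solve 2 (λ l d → l :+ d := con (+ 1) :+ l :+ (con -[1+ 0 ] :+ d)) refl l d
  step : ∀ d → x ℤ.* δ d (+ 0) ℤ.+ coeffZᶻ c (-[1+ 0 ] ℤ.+ d) ≡ coeffZᶻ (x ∷ c) d
  step (+ zero)  = trans (ℤP.+-identityʳ _) (ℤP.*-identityʳ x)
  step (+ suc j) = trans (cong (ℤ._+ coeffZ c j) (ℤP.*-zeroʳ x)) (ℤP.+-identityˡ _)
  step -[1+ j ]  = trans (ℤP.+-identityʳ _) (ℤP.*-zeroʳ x)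

coeffL≡pairingL : ∀ p k → coeffL p k ≡ pairingL p (δ k)
coeffL≡pairingL (mkL l c) k = trans (coeffL≡coeffZᶻ l c k) (sym (trans
  (cong (λ k → pairing c l (δ k)) (solve 2 (λ k l → k := l :+ (k :+ :- l)) refl k l))
  (pairing-δ c l (k ℤ.- l))))

-- Dividing C n by (1-q)² and reading off one coefficient pairs C n with a tent function; the factor
-- -w = (q-1)²/q then takes its second difference, which isolates the apex exponent s = n + i.
tent : ℕ → ℤ → ℤ
tent s (+ m)      = + (s ∸ m)
tent s -[1+ _ ]   = + 0

sumTo-δ-zero : ∀ J (g : ℕ → ℤ) a → (∀ k → k ≤ J → ¬ a ≡ + k) → sumTo J (λ k → g k ℤ.* δ (+ k) a) ≡ + 0
sumTo-δ-zero zero g a a≢ = trans (cong (g 0 ℤ.*_) (χ-false (a ℤ.≟ + 0) (a≢ 0 z≤n))) (ℤP.*-zeroʳ (g 0))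
sumTo-δ-zero (suc J) g a a≢ = cong₂ ℤ._+_ (sumTo-δ-zero J g a (λ k k≤J → a≢ k (ℕP.m≤n⇒m≤1+n k≤J)))
  (trans (cong (g (suc J) ℤ.*_) (χ-false (a ℤ.≟ + suc J) (a≢ (suc J) ℕP.≤-refl))) (ℤP.*-zeroʳ (g (suc J))))

sumTo-δ : ∀ J (g : ℕ → ℤ) m → m ≤ J → sumTo J (λ k → g k ℤ.* δ (+ k) (+ m)) ≡ g m
sumTo-δ zero g .0 z≤n = ℤP.*-identityʳ (g 0)
sumTo-δ (suc J) g m m≤1+J with m ℕ.≟ suc J
... | yes refl = trans (cong₂ ℤ._+_
        (sumTo-δ-zero J g (+ suc J) (λ k k≤J eq → ℕP.<⇒≢ (s≤s k≤J) (sym (ℤP.+-injective eq))))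
        (trans (cong (g (suc J) ℤ.*_) (χ-true (+ suc J ℤ.≟ + suc J) refl)) (ℤP.*-identityʳ (g (suc J)))))
      (ℤP.+-identityˡ _)
... | no m≢1+J = trans (cong₂ ℤ._+_
        (sumTo-δ J g m (ℕP.≤-pred (ℕP.≤∧≢⇒< m≤1+J m≢1+J)))
        (trans (cong (g (suc J) ℤ.*_) (χ-false (+ m ℤ.≟ + suc J) (λ eq → m≢1+J (ℤP.+-injective eq)))) (ℤP.*-zeroʳ (g (suc J)))))
      (ℤP.+-identityʳ _)

sumTo-tent : ∀ J a → sumTo J (λ k → + suc (J ∸ k) ℤ.* δ (+ k) a) ≡ tent (suc J) a
sumTo-tent J -[1+ m ] = sumTo-δ-zero J (λ k → + suc (J ∸ k)) -[1+ m ] (λ k _ ())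
sumTo-tent J (+ m) with m ℕ.≤? J
... | yes m≤J = trans (sumTo-δ J (λ k → + suc (J ∸ k)) m m≤J) (cong +_ (sym (ℕP.+-∸-assoc 1 m≤J)))
... | no m≰J  = trans (sumTo-δ-zero J (λ k → + suc (J ∸ k)) (+ m) (λ k k≤J eq → m≰J (≡.subst (_≤ J) (sym (ℤP.+-injective eq)) k≤J)))
                      (cong +_ (sym (ℕP.m≤n⇒m∸n≡0 (ℕP.≰⇒> m≰J))))

-- The three points `m`, `suc m`, `suc (suc m)` are nonnegative on purpose: extended by zero, the
-- tent jumps between -1 and 0, and for s > 0 the formula fails across that jump.
tent-second-difference : ∀ s m →
  + (s ∸ suc m) ℤ.+ + (s ∸ suc m) ℤ.- (+ (s ∸ suc (suc m)) ℤ.+ + (s ∸ m)) ≡ ℤ.- χ (suc m ℕ.≟ s)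
tent-second-difference zero          m       rewrite ℕP.0∸n≡0 m = refl
tent-second-difference (suc zero)    zero    = refl
tent-second-difference (suc (suc s)) zero    =
  solve 1 (λ s → con (+ 1) :+ s :+ (con (+ 1) :+ s) :+ :- (s :+ (con (+ 2) :+ s)) := con (+ 0)) refl (+ s)
tent-second-difference (suc s)       (suc m) = tent-second-difference s m

tri : ℕ → ℕ
tri zero    = 0
tri (suc k) = suc k ℕ.+ tri k

sgn : ℕ → ℤ
sgn zero    = + 1
sgn (suc k) = ℤ.- sgn k

⟦⟧-⊖⊗ : ∀ x y φ → ⟦ (⊖ x) ⊗ y ⟧ φ ≡ ℤ.- ⟦ x ⊗ y ⟧ φ
⟦⟧-⊖⊗ x y φ = trans (⟦⟧-⊗ (⊖ x) y φ) (trans (⟦⟧-⊖ x _) (cong ℤ.-_ (sym (⟦⟧-⊗ x y φ))))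

∑ : ℕ → (ℕ → ℤ) → ℤ
∑ zero    f = + 0
∑ (suc n) f = ∑ n f ℤ.+ f n

Δ² : (ℤ → ℤ) → ℤ → ℤ
Δ² ψ a = ψ a ℤ.+ ψ a ℤ.- (ψ (+ 1 ℤ.+ a) ℤ.+ ψ (-[1+ 0 ] ℤ.+ a))

symmetricSum : ℕ → (ℤ → ℤ) → ℤ
symmetricSum zero    g = g (+ 0)
symmetricSum (suc j) g = symmetricSum j g ℤ.+ (g (+ suc j) ℤ.+ g -[1+ j ])

symmetricSum-cong : ∀ j {f g} → (∀ a → f a ≡ g a) → symmetricSum j f ≡ symmetricSum j g
symmetricSum-cong zero    eq = eq (+ 0)
symmetricSum-cong (suc j) eq = cong₂ ℤ._+_ (symmetricSum-cong j eq) (cong₂ ℤ._+_ (eq (+ suc j)) (eq -[1+ j ]))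

symmetricSum-scale : ∀ j c g → symmetricSum j (λ a → c ℤ.* g a) ≡ c ℤ.* symmetricSum j g
symmetricSum-scale zero    c g = refl
symmetricSum-scale (suc j) c g = trans (cong (ℤ._+ (c ℤ.* g (+ suc j) ℤ.+ c ℤ.* g -[1+ j ])) (symmetricSum-scale j c g))
  (solve 4 (λ c x y z → c :* x :+ (c :* y :+ c :* z) := c :* (x :+ (y :+ z))) refl c (symmetricSum j g) (g (+ suc j)) (g -[1+ j ]))

-- Functionals applied to the terms of the expansion

module Extraction (N : ℕ) where
  open CommutativeRing (truncatedRing N) using (commutativeSemiring; _≈_)
    renaming (refl to ≈-refl; trans to ≈-trans; *-congʳ to ⊗-congʳ)
  open Exp commutativeSemiring using (_^_) public
  open Expansion (truncatedRing N) using (ι; module LaurentEval; module PartialFractions; module ProductFormula)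

  q q⁻¹ t : Sum
  q   = (+ 1 , + 1 , 0) ∷ []
  q⁻¹ = (+ 1 , -[1+ 0 ] , 0) ∷ []
  t   = (+ 1 , + 0 , 1) ∷ []

  ⟦monomial^⟧-⊗ : ∀ a b n y φ →
    ⟦ (((+ 1 , a , b) ∷ []) ^ n) ⊗ y ⟧ φ ≡ ⟦ y ⟧ (shift (+ n ℤ.* a) (n ℕ.* b) φ)
  ⟦monomial^⟧-⊗ a b zero y φ = trans (⊗-identityˡ y φ)
    (⟦⟧-cong y (λ a′ b′ → cong (λ a′ → φ a′ b′) (sym (ℤP.+-identityˡ a′))))
  ⟦monomial^⟧-⊗ a b (suc n) y φ = begin
    ⟦ (x ⊗ (x ^ n)) ⊗ y ⟧ φ                                  ≡⟨ ⊗-assoc x (x ^ n) y φ ⟩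
    ⟦ x ⊗ ((x ^ n) ⊗ y) ⟧ φ                                  ≡⟨ ⟦monomial⟧-⊗ a b ((x ^ n) ⊗ y) φ ⟩
    ⟦ (x ^ n) ⊗ y ⟧ (shift a b φ)                            ≡⟨ ⟦monomial^⟧-⊗ a b n y (shift a b φ) ⟩
    ⟦ y ⟧ (shift (+ n ℤ.* a) (n ℕ.* b) (shift a b φ))        ≡⟨ ⟦⟧-cong y (λ a′ b′ → cong₂ φ
                                                                  (solve 3 (λ a a′ n → a :+ (n :* a :+ a′) := (con (+ 1) :+ n) :* a :+ a′) refl a a′ (+ n))
                                                                  (sym (ℕP.+-assoc b (n ℕ.* b) b′))) ⟩
    ⟦ y ⟧ (shift (+ suc n ℤ.* a) (suc n ℕ.* b) φ)            ∎
    where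
    open ≡.≡-Reasoning
    x = (+ 1 , a , b) ∷ []

  ⟦monomial^⟧ : ∀ a b n φ → ⟦ ((+ 1 , a , b) ∷ []) ^ n ⟧ φ ≡ φ (+ n ℤ.* a) (n ℕ.* b)
  ⟦monomial^⟧ a b n φ = begin
    ⟦ x ⟧ φ                                         ≡⟨ ⊗-identityˡ x φ ⟨
    ⟦ one ⊗ x ⟧ φ                                   ≡⟨ ⊗-comm one x φ ⟩
    ⟦ x ⊗ one ⟧ φ                                   ≡⟨ ⟦monomial^⟧-⊗ a b n one φ ⟩
    + 1 ℤ.* φ (+ n ℤ.* a ℤ.+ + 0) (n ℕ.* b ℕ.+ 0) ℤ.+ + 0
                                                    ≡⟨ trans (ℤP.+-identityʳ _) (ℤP.*-identityˡ _) ⟩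
    φ (+ n ℤ.* a ℤ.+ + 0) (n ℕ.* b ℕ.+ 0)           ≡⟨ cong₂ φ (ℤP.+-identityʳ _) (ℕP.+-identityʳ _) ⟩
    φ (+ n ℤ.* a) (n ℕ.* b)                         ∎
    where
    open ≡.≡-Reasoning
    x = ((+ 1 , a , b) ∷ []) ^ n

  ⟦t^⟧-⊗ : ∀ n y φ → ⟦ (t ^ n) ⊗ y ⟧ φ ≡ ⟦ y ⟧ (shift (+ 0) n φ)
  ⟦t^⟧-⊗ n y φ = trans (⟦monomial^⟧-⊗ (+ 0) 1 n y φ)
    (cong₂ (λ a b → ⟦ y ⟧ (shift a b φ)) (ℤP.*-zeroʳ (+ n)) (ℕP.*-identityʳ n))

  t-nilpotent : ∀ m → N < m → (t ^ m) ≈ []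
  t-nilpotent m N<m = tested λ φ φ-vanishes → trans (⟦monomial^⟧ (+ 0) 1 m φ)
    (φ-vanishes _ _ (≡.subst (N <_) (sym (ℕP.*-identityʳ m)) N<m))

  qq⁻¹≈1 : (q ⊗ q⁻¹) ≈ one
  qq⁻¹≈1 = ≈-refl

  open LaurentEval q q⁻¹ qq⁻¹≈1 public
  open PartialFractions q q⁻¹ t qq⁻¹≈1 using (w; e; H) public
  open ProductFormula q q⁻¹ t qq⁻¹≈1 N t-nilpotent using (evalT; Σ-tH; Σ-eH; prodT-expansion) public

  ⟦ι⟧⁺ : ∀ n φ → ⟦ ι (+ n) ⟧ φ ≡ + n ℤ.* φ (+ 0) 0
  ⟦ι⟧⁺ zero          φ = refl
  ⟦ι⟧⁺ (suc zero)    φ = ℤP.+-identityʳ _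
  ⟦ι⟧⁺ (suc (suc n)) φ = trans (⟦⟧-++ (ι (+ suc n)) one φ)
    (trans (cong (ℤ._+ ⟦ one ⟧ φ) (⟦ι⟧⁺ (suc n) φ))
    (solve 2 (λ n f → (con (+ 1) :+ n) :* f :+ (con (+ 1) :* f :+ con (+ 0)) := (con (+ 2) :+ n) :* f) refl (+ n) (φ (+ 0) 0)))

  ⟦ι⟧ : ∀ c φ → ⟦ ι c ⟧ φ ≡ c ℤ.* φ (+ 0) 0
  ⟦ι⟧ (+ n)    φ = ⟦ι⟧⁺ n φ
  ⟦ι⟧ -[1+ n ] φ = trans (⟦⟧-⊖ (ι (+ suc n)) φ)
    (trans (cong ℤ.-_ (⟦ι⟧⁺ (suc n) φ)) (ℤP.neg-distribˡ-* (+ suc n) (φ (+ 0) 0)))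

  ⟦qᶻ⟧-⊗ : ∀ l y φ → ⟦ qᶻ l ⊗ y ⟧ φ ≡ ⟦ y ⟧ (shift l 0 φ)
  ⟦qᶻ⟧-⊗ (+ n) y φ = trans (⟦monomial^⟧-⊗ (+ 1) 0 n y φ)
    (cong₂ (λ a b → ⟦ y ⟧ (shift a b φ)) (ℤP.*-identityʳ (+ n)) (ℕP.*-zeroʳ n))
  ⟦qᶻ⟧-⊗ -[1+ n ] y φ = trans (⟦monomial^⟧-⊗ -[1+ 0 ] 0 (suc n) y φ)
    (cong₂ (λ a b → ⟦ y ⟧ (shift a b φ)) (suc*-1 n) (ℕP.*-zeroʳ n))
    where
    suc*-1 : ∀ n → + suc n ℤ.* -[1+ 0 ] ≡ -[1+ n ]
    suc*-1 n = cong -[1+_] (ℕP.*-identityʳ n)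

  ⟦evalZ⟧ : ∀ c l φ → ⟦ evalZ c ⟧ (shift l 0 φ) ≡ pairing c l (λ a → φ a 0)
  ⟦evalZ⟧ []      l φ = refl
  ⟦evalZ⟧ (x ∷ c) l φ = begin
    ⟦ ι x ++ (q ⊗ evalZ c) ⟧ (shift l 0 φ)                          ≡⟨ ⟦⟧-++ (ι x) (q ⊗ evalZ c) _ ⟩
    ⟦ ι x ⟧ (shift l 0 φ) ℤ.+ ⟦ q ⊗ evalZ c ⟧ (shift l 0 φ)         ≡⟨ cong₂ ℤ._+_ head tail ⟩
    x ℤ.* φ l 0 ℤ.+ pairing c (+ 1 ℤ.+ l) (λ a → φ a 0)             ∎
    where
    open ≡.≡-Reasoning
    head : ⟦ ι x ⟧ (shift l 0 φ) ≡ x ℤ.* φ l 0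
    head = trans (⟦ι⟧ x (shift l 0 φ)) (cong (λ a → x ℤ.* φ a 0) (ℤP.+-identityʳ l))
    tail : ⟦ q ⊗ evalZ c ⟧ (shift l 0 φ) ≡ pairing c (+ 1 ℤ.+ l) (λ a → φ a 0)
    tail = trans (⟦monomial⟧-⊗ (+ 1) 0 (evalZ c) (shift l 0 φ))
      (trans (⟦⟧-cong (evalZ c) (λ a b → cong (λ a → φ a b)
               (solve 2 (λ l a → l :+ (con (+ 1) :+ a) := con (+ 1) :+ l :+ a) refl l a)))
             (⟦evalZ⟧ c (+ 1 ℤ.+ l) φ))

  ⟦evalL⟧ : ∀ p φ → ⟦ evalL p ⟧ φ ≡ pairingL p (λ a → φ a 0)
  ⟦evalL⟧ (mkL l c) φ = trans (⟦qᶻ⟧-⊗ l (evalZ c) φ) (⟦evalZ⟧ c l φ)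

  at : ℕ → (ℤ → ℤ) → ℤ → ℕ → ℤ
  at m ψ a b = χ (b ℕ.≟ m) ℤ.* ψ a

  at-vanishing : ∀ m ψ → m ≤ N → Vanishing N (at m ψ)
  at-vanishing m ψ m≤N a b N<b = cong (ℤ._* ψ a) (χ-false (b ℕ.≟ m) (λ { refl → ℕP.<⇒≱ N<b m≤N }))

  ⟦evalT⟧ : ∀ f m ψ → ⟦ evalT f ⟧ (at m ψ) ≡ pairingL (coeffT f m) ψ
  ⟦evalT⟧ []      m ψ = refl
  ⟦evalT⟧ (p ∷ f) m ψ = trans (⟦⟧-++ (evalL p) (t ⊗ evalT f) (at m ψ))
    (trans (cong₂ ℤ._+_ (⟦evalL⟧ p (at m ψ)) (⟦monomial⟧-⊗ (+ 0) 1 (evalT f) (at m ψ))) (step m))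
    where
    step : ∀ m → pairingL p (λ a → at m ψ a 0) ℤ.+ ⟦ evalT f ⟧ (shift (+ 0) 1 (at m ψ)) ≡ pairingL (coeffT (p ∷ f) m) ψ
    step zero = trans (cong₂ ℤ._+_ (pairingL-cong p (λ a → ℤP.*-identityˡ (ψ a))) (⟦⟧-zero (evalT f))) (ℤP.+-identityʳ _)
    step (suc m) = trans (cong₂ ℤ._+_ (pairingL-zero p)
        (trans (⟦⟧-cong (evalT f) (λ a b → cong (λ a → χ (b ℕ.≟ m) ℤ.* ψ a) (ℤP.+-identityˡ a))) (⟦evalT⟧ f m ψ)))
      (ℤP.+-identityˡ _)

  -- `evalL p` involves no `t`, so testing for b = 0 loses nothing; it makes the functional vanish
  -- above N, as `test` demands.
  coeffL-qPow* : ∀ n p k → coeffL (qPow (+ n) *L p) k ≡ ⟦ evalL p ⟧ (λ a b → at 0 (δ k) (+ n ℤ.+ a) b)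
  coeffL-qPow* n p k = begin
    coeffL (qPow (+ n) *L p) k                             ≡⟨ coeffL≡pairingL (qPow (+ n) *L p) k ⟩
    pairingL (qPow (+ n) *L p) (δ k)                       ≡⟨ pairingL-cong (qPow (+ n) *L p) (λ a → ℤP.*-identityˡ (δ k a)) ⟨
    pairingL (qPow (+ n) *L p) (λ a → at 0 (δ k) a 0)      ≡⟨ ⟦evalL⟧ (qPow (+ n) *L p) (at 0 (δ k)) ⟨
    ⟦ evalL (qPow (+ n) *L p) ⟧ (at 0 (δ k))               ≡⟨ test (≈-trans (evalL-* (qPow (+ n)) p) (⊗-congʳ (evalL-qPow (+ n))))
                                                                   (at 0 (δ k)) (at-vanishing 0 (δ k) z≤n) ⟩
    ⟦ qᶻ (+ n) ⊗ evalL p ⟧ (at 0 (δ k))                    ≡⟨ ⟦qᶻ⟧-⊗ (+ n) (evalL p) (at 0 (δ k)) ⟩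
    ⟦ evalL p ⟧ (shift (+ n) 0 (at 0 (δ k)))               ∎
    where open ≡.≡-Reasoning

  ⟦e⟧-⊗ : ∀ k y φ → ⟦ e k ⊗ y ⟧ φ ≡ sgn k ℤ.* ⟦ y ⟧ (shift (+ 0) (tri k) φ)
  ⟦e⟧-⊗ zero y φ = trans (⟦monomial⟧-⊗ (+ 0) 0 y φ) (sym (ℤP.*-identityˡ _))
  ⟦e⟧-⊗ (suc k) y φ = begin
    ⟦ (⊖ ((t ^ suc k) ⊗ e k)) ⊗ y ⟧ φ                                   ≡⟨ ⟦⟧-⊖⊗ ((t ^ suc k) ⊗ e k) y φ ⟩
    ℤ.- ⟦ ((t ^ suc k) ⊗ e k) ⊗ y ⟧ φ                                   ≡⟨ cong ℤ.-_ (⊗-assoc (t ^ suc k) (e k) y φ) ⟩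
    ℤ.- ⟦ (t ^ suc k) ⊗ (e k ⊗ y) ⟧ φ                                   ≡⟨ cong ℤ.-_ (⟦t^⟧-⊗ (suc k) (e k ⊗ y) φ) ⟩
    ℤ.- ⟦ e k ⊗ y ⟧ (shift (+ 0) (suc k) φ)                             ≡⟨ cong ℤ.-_ (⟦e⟧-⊗ k y _) ⟩
    ℤ.- (sgn k ℤ.* ⟦ y ⟧ (shift (+ 0) (tri k) (shift (+ 0) (suc k) φ))) ≡⟨ ℤP.neg-distribˡ-* (sgn k) _ ⟩
    sgn (suc k) ℤ.* ⟦ y ⟧ (shift (+ 0) (tri k) (shift (+ 0) (suc k) φ)) ≡⟨ cong (sgn (suc k) ℤ.*_) (⟦⟧-cong y (λ a b → cong₂ φ
                                                                              (ℤP.+-identityˡ (+ 0 ℤ.+ a)) (sym (ℕP.+-assoc (suc k) (tri k) b)))) ⟩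
    sgn (suc k) ℤ.* ⟦ y ⟧ (shift (+ 0) (tri (suc k)) φ)                 ∎
    where open ≡.≡-Reasoning

  second-difference : (ℤ → ℕ → ℤ) → ℤ → ℕ → ℤ
  second-difference φ a b = φ a b ℤ.+ φ a b ℤ.- (φ (+ 1 ℤ.+ a) b ℤ.+ φ (-[1+ 0 ] ℤ.+ a) b)

  ⟦w⟧-⊗ : ∀ y φ → ⟦ w ⊗ y ⟧ φ ≡ ⟦ y ⟧ (second-difference φ)
  ⟦w⟧-⊗ y φ = begin
    -- Commuting puts `w` innermost, where it unfolds to its four monomials at each exponent of y.
    ⟦ w ⊗ y ⟧ φ                           ≡⟨ ⊗-comm w y φ ⟩
    ⟦ y ⊗ w ⟧ φ                           ≡⟨ ⟦⟧-⊗ y w φ ⟩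
    ⟦ y ⟧ (λ a b → ⟦ w ⟧ (shift a b φ))   ≡⟨ ⟦⟧-cong y pointwise ⟩
    ⟦ y ⟧ (second-difference φ)           ∎
    where
    open ≡.≡-Reasoning
    pointwise : ∀ a b → ⟦ w ⟧ (shift a b φ) ≡ second-difference φ a b
    pointwise a b rewrite ℕP.+-identityʳ b | ℤP.+-identityʳ a | ℤP.+-comm a (+ 1) | ℤP.+-comm a -[1+ 0 ] =
      solve 3 (λ x y z → con (+ 1) :* x :+ (con (+ 1) :* x :+ (con -[1+ 0 ] :* y :+ (con -[1+ 0 ] :* z :+ con (+ 0))))
                         := x :+ x :+ :- (y :+ z)) refl (φ a b) (φ (+ 1 ℤ.+ a) b) (φ (-[1+ 0 ] ℤ.+ a) b)

  ⟦H⟧ : ∀ j φ → ⟦ H j ⟧ φ ≡ symmetricSum j (λ a → φ a 0)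
  ⟦H⟧ zero    φ = trans (ℤP.+-identityʳ _) (ℤP.*-identityˡ _)
  ⟦H⟧ (suc j) φ = trans (⟦⟧-++ (H j) ((q ^ suc j) ++ (q⁻¹ ^ suc j)) φ) (cong₂ ℤ._+_ (⟦H⟧ j φ)
    (trans (⟦⟧-++ (q ^ suc j) (q⁻¹ ^ suc j) φ) (cong₂ ℤ._+_
      (trans (⟦monomial^⟧ (+ 1) 0 (suc j) φ) (cong₂ φ (ℤP.*-identityʳ (+ suc j)) (ℕP.*-zeroʳ j)))
      (trans (⟦monomial^⟧ -[1+ 0 ] 0 (suc j) φ) (cong₂ φ (cong -[1+_] (ℕP.*-identityʳ j)) (ℕP.*-zeroʳ j))))))

  ⟦etH⟧ : ∀ k j m ψ →
    ⟦ e k ⊗ ((t ^ (k ℕ.* j)) ⊗ (w ⊗ H j)) ⟧ (at m ψ)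
      ≡ sgn k ℤ.* (χ (tri k ℕ.+ k ℕ.* j ℕ.≟ m) ℤ.* symmetricSum j (Δ² ψ))
  ⟦etH⟧ k j m ψ = begin
    ⟦ e k ⊗ ((t ^ (k ℕ.* j)) ⊗ (w ⊗ H j)) ⟧ (at m ψ)    ≡⟨ ⟦e⟧-⊗ k _ (at m ψ) ⟩
    sgn k ℤ.* ⟦ (t ^ (k ℕ.* j)) ⊗ (w ⊗ H j) ⟧ φ₁        ≡⟨ cong (sgn k ℤ.*_) (⟦t^⟧-⊗ (k ℕ.* j) (w ⊗ H j) φ₁) ⟩
    sgn k ℤ.* ⟦ w ⊗ H j ⟧ φ₂                            ≡⟨ cong (sgn k ℤ.*_) (⟦w⟧-⊗ (H j) φ₂) ⟩
    sgn k ℤ.* ⟦ H j ⟧ (second-difference φ₂)            ≡⟨ cong (sgn k ℤ.*_) (⟦H⟧ j (second-difference φ₂)) ⟩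
    sgn k ℤ.* symmetricSum j (λ a → second-difference φ₂ a 0)
                                                        ≡⟨ cong (sgn k ℤ.*_) (trans (symmetricSum-cong j pointwise) (symmetricSum-scale j c (Δ² ψ))) ⟩
    sgn k ℤ.* (c ℤ.* symmetricSum j (Δ² ψ))             ∎
    where
    open ≡.≡-Reasoning
    φ₁ = shift (+ 0) (tri k) (at m ψ)
    φ₂ = shift (+ 0) (k ℕ.* j) φ₁
    c = χ (tri k ℕ.+ k ℕ.* j ℕ.≟ m)
    φ₂≡ : ∀ a → φ₂ a 0 ≡ c ℤ.* ψ a
    φ₂≡ a rewrite ℕP.+-identityʳ (k ℕ.* j) = cong (λ a → c ℤ.* ψ a)
      (trans (ℤP.+-identityˡ (+ 0 ℤ.+ a)) (ℤP.+-identityˡ a))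
    pointwise : ∀ a → second-difference φ₂ a 0 ≡ c ℤ.* Δ² ψ a
    pointwise a rewrite φ₂≡ a | φ₂≡ (+ 1 ℤ.+ a) | φ₂≡ (-[1+ 0 ] ℤ.+ a) =
      solve 4 (λ c x y z → c :* x :+ c :* x :+ :- (c :* y :+ c :* z) := c :* (x :+ x :+ :- (y :+ z)))
        refl c (ψ a) (ψ (+ 1 ℤ.+ a)) (ψ (-[1+ 0 ] ℤ.+ a))

-- The coefficient as an alternating sum of counts

module Coefficient (n′ i : ℕ) where
  n = suc n′
  open Extraction n

  -- The shift by n is the factor qⁿ in `C n`. The apex n + i exceeds the exponent read by `a` by
  -- one, because the weight at that exponent is 1 and drops to zero only one step later.
  ψ : ℤ → ℤ
  ψ a = tent (n ℕ.+ i) (+ n ℤ.+ a)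

  a≡⟦prodT⟧ : a n i ≡ ⟦ evalT (prodT n n) ⟧ (at n ψ)
  a≡⟦prodT⟧ = begin
    sumTo J (λ k → + suc (J ∸ k) ℤ.* coeffL (C n) (+ k))
      ≡⟨ sumTo-cong J (λ k _ → cong (+ suc (J ∸ k) ℤ.*_) (coeffL-qPow* n c (+ k))) ⟩
    sumTo J (λ k → + suc (J ∸ k) ℤ.* ⟦ evalL c ⟧ (λ a b → at 0 (δ (+ k)) (+ n ℤ.+ a) b))
      ≡⟨ sumTo-⟦⟧ J (evalL c) (λ k → + suc (J ∸ k)) (λ k a b → at 0 (δ (+ k)) (+ n ℤ.+ a) b) ⟩
    ⟦ evalL c ⟧ (λ a b → sumTo J (λ k → + suc (J ∸ k) ℤ.* at 0 (δ (+ k)) (+ n ℤ.+ a) b))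
      ≡⟨ ⟦evalL⟧ c _ ⟩
    pairingL c (λ a → sumTo J (λ k → + suc (J ∸ k) ℤ.* at 0 (δ (+ k)) (+ n ℤ.+ a) 0))
      ≡⟨ pairingL-cong c (λ a → trans
           (sumTo-cong J (λ k _ → cong (+ suc (J ∸ k) ℤ.*_) (ℤP.*-identityˡ (δ (+ k) (+ n ℤ.+ a)))))
           (sumTo-tent J (+ n ℤ.+ a))) ⟩
    pairingL c ψ
      ≡⟨ ⟦evalT⟧ (prodT n n) n ψ ⟨
    ⟦ evalT (prodT n n) ⟧ (at n ψ) ∎
    where
    open ≡.≡-Reasoning
    J = n′ ℕ.+ i
    c = coeffT (prodT n n) n

  Δ²ψ : ∀ a m → + n ℤ.+ a ≡ + suc m → Δ² ψ a ≡ ℤ.- χ (suc m ℕ.≟ n ℕ.+ i)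
  Δ²ψ a m n+a≡1+m = trans
    (cong₂ (λ x y → x ℤ.+ x ℤ.- y) (cong (tent s) n+a≡1+m) (cong₂ ℤ._+_ (cong (tent s) up) (cong (tent s) down)))
    (tent-second-difference s m)
    where
    s = n ℕ.+ i
    up : + n ℤ.+ (+ 1 ℤ.+ a) ≡ + suc (suc m)
    up = trans (solve 2 (λ n a → n :+ (con (+ 1) :+ a) := con (+ 1) :+ (n :+ a)) refl (+ n) a) (cong (λ x → + 1 ℤ.+ x) n+a≡1+m)
    down : + n ℤ.+ (-[1+ 0 ] ℤ.+ a) ≡ + m
    down = trans (solve 2 (λ n a → n :+ (con -[1+ 0 ] :+ a) := con -[1+ 0 ] :+ (n :+ a)) refl (+ n) a) (cong (λ x → -[1+ 0 ] ℤ.+ x) n+a≡1+m)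

  -- Only a = i reaches the apex n + i, and the window |a| ≤ j contains it exactly when i ≤ j. The
  -- bound j < n keeps every exponent n + a positive, away from the jump of the tent at zero.
  symmetricSum-Δ²ψ : ∀ j → j < n → symmetricSum j (Δ² ψ) ≡ ℤ.- χ (i ℕ.≤? j)
  symmetricSum-Δ²ψ zero _ = trans (Δ²ψ (+ 0) n′ (ℤP.+-identityʳ (+ n)))
    (cong ℤ.-_ (χ-cong (n ℕ.≟ n ℕ.+ i) (i ℕ.≤? 0)
      (λ eq → ℕP.≤-reflexive (ℕP.+-cancelˡ-≡ n i 0 (trans (sym eq) (sym (ℕP.+-identityʳ n)))))
      (λ { z≤n → sym (ℕP.+-identityʳ n) })))
  symmetricSum-Δ²ψ (suc j) 1+j<n = begin
    symmetricSum j (Δ² ψ) ℤ.+ (Δ² ψ (+ suc j) ℤ.+ Δ² ψ -[1+ j ])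
      ≡⟨ cong₂ ℤ._+_ (symmetricSum-Δ²ψ j (ℕP.<⇒≤ 1+j<n)) (cong₂ ℤ._+_ right left) ⟩
    ℤ.- χ (i ℕ.≤? j) ℤ.+ (ℤ.- χ (i ℕ.≟ suc j) ℤ.+ + 0)
      ≡⟨ solve 2 (λ x y → :- x :+ (:- y :+ con (+ 0)) := :- (x :+ y)) refl (χ (i ℕ.≤? j)) (χ (i ℕ.≟ suc j)) ⟩
    ℤ.- (χ (i ℕ.≤? j) ℤ.+ χ (i ℕ.≟ suc j))
      ≡⟨ cong ℤ.-_ merge ⟩
    ℤ.- χ (i ℕ.≤? suc j) ∎
    where
    open ≡.≡-Reasoning
    right : Δ² ψ (+ suc j) ≡ ℤ.- χ (i ℕ.≟ suc j)
    right = trans (Δ²ψ (+ suc j) (n′ ℕ.+ suc j) refl) (cong ℤ.-_ (χ-cong (n ℕ.+ suc j ℕ.≟ n ℕ.+ i) (i ℕ.≟ suc j)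
      (λ eq → sym (ℕP.+-cancelˡ-≡ n (suc j) i eq)) (λ eq → cong (n ℕ.+_) (sym eq))))
    left : Δ² ψ -[1+ j ] ≡ + 0
    -- The exponent n - (j+1) lies strictly below n and therefore never meets the apex n + i.
    left = trans (Δ²ψ -[1+ j ] (n′ ∸ suc j) n-[1+j])
      (cong ℤ.-_ (χ-false (suc (n′ ∸ suc j) ℕ.≟ n ℕ.+ i)
        (λ eq → ℕP.<⇒≢ (ℕP.≤-trans (s≤s (s≤s (ℕP.m∸n≤m (n′ ∸ 1) j))) (ℕP.≤-trans (s≤s n′≤) (ℕP.m≤m+n n i))) (trans eq′ eq))))
      where
      n-[1+j] : n ℤ.⊖ suc j ≡ + suc (n′ ∸ suc j)
      n-[1+j] = trans (ℤP.⊖-≥ (ℕP.<⇒≤ 1+j<n)) (cong +_ (ℕP.+-∸-assoc 1 (ℕP.≤-pred 1+j<n)))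
      n′≤ : suc (n′ ∸ 1) ≤ n′
      n′≤ = ℕP.≤-reflexive (ℕP.m+[n∸m]≡n (ℕP.≤-trans (s≤s z≤n) (ℕP.≤-pred 1+j<n)))
      eq′ : suc (n′ ∸ 1 ∸ j) ≡ suc (n′ ∸ suc j)
      eq′ = cong suc (ℕP.∸-+-assoc n′ 1 j)
    merge : χ (i ℕ.≤? j) ℤ.+ χ (i ℕ.≟ suc j) ≡ χ (i ℕ.≤? suc j)
    merge with ℕP.<-cmp i (suc j)
    ... | tri< i<1+j i≢1+j _ rewrite χ-true (i ℕ.≤? j) (ℕP.≤-pred i<1+j) | χ-false (i ℕ.≟ suc j) i≢1+j
                                   | χ-true (i ℕ.≤? suc j) (ℕP.<⇒≤ i<1+j) = refl
    ... | tri≈ i≮1+j i≡1+j _ rewrite χ-false (i ℕ.≤? j) (λ i≤j → i≮1+j (s≤s i≤j)) | χ-true (i ℕ.≟ suc j) i≡1+j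
                                   | χ-true (i ℕ.≤? suc j) (ℕP.≤-reflexive i≡1+j) = refl
    ... | tri> i≮1+j i≢1+j i>1+j rewrite χ-false (i ℕ.≤? j) (λ i≤j → i≮1+j (s≤s i≤j)) | χ-false (i ℕ.≟ suc j) i≢1+j
                                   | χ-false (i ℕ.≤? suc j) (ℕP.<⇒≱ i>1+j) = refl

  hits : ℕ → ℕ → ℤ
  hits k j = χ (tri k ℕ.+ k ℕ.* j ℕ.≟ n) ℤ.* χ (i ℕ.≤? j)

  -- Two signs cancel: the one that distinguishes `sgn (suc k)` from `sgn k`, and the one from the
  -- second difference of the tent.
  ⟦etH⟧-hits : ∀ k j →
    ⟦ e (suc k) ⊗ ((t ^ (suc k ℕ.* j)) ⊗ (w ⊗ H j)) ⟧ (at n ψ) ≡ sgn k ℤ.* hits (suc k) j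
  ⟦etH⟧-hits k j = trans (⟦etH⟧ (suc k) j n ψ)
    (χ-guarded-neg (tri (suc k) ℕ.+ suc k ℕ.* j ℕ.≟ n) (sgn k) (λ hit → symmetricSum-Δ²ψ j (j<n hit)))
    where
    j<n : tri (suc k) ℕ.+ suc k ℕ.* j ≡ n → j < n
    j<n hit = ℕP.≤-trans (s≤s (ℕP.≤-trans (ℕP.m≤m+n j (k ℕ.* j)) (ℕP.m≤n+m (suc k ℕ.* j) (k ℕ.+ tri k)))) (ℕP.≤-reflexive hit)

  ⟦Σ-tH⟧ : ∀ k J → ⟦ Σ-tH (suc k) J ⟧ (at n ψ) ≡ sgn k ℤ.* sumTo J (hits (suc k))
  ⟦Σ-tH⟧ k zero    = ⟦etH⟧-hits k 0
  ⟦Σ-tH⟧ k (suc J) = trans (⟦⟧-++ (Σ-tH (suc k) J) _ (at n ψ))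
    (trans (cong₂ ℤ._+_ (⟦Σ-tH⟧ k J) (⟦etH⟧-hits k (suc J)))
           (sym (ℤP.*-distribˡ-+ (sgn k) (sumTo J (hits (suc k))) (hits (suc k) (suc J)))))

  ⟦Σ-eH⟧ : ∀ K → ⟦ Σ-eH K ⟧ (at n ψ) ≡ ∑ K (λ k → sgn k ℤ.* sumTo n (hits (suc k)))
  ⟦Σ-eH⟧ zero    = refl
  ⟦Σ-eH⟧ (suc K) = trans (⟦⟧-++ (Σ-eH K) (Σ-tH (suc K) n) (at n ψ)) (cong₂ ℤ._+_ (⟦Σ-eH⟧ K) (⟦Σ-tH⟧ K n))

  coefficient-formula : a n i ≡ ∑ n (λ k → sgn k ℤ.* sumTo n (hits (suc k)))
  coefficient-formula = begin
    a n i                                                ≡⟨ a≡⟦prodT⟧ ⟩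
    ⟦ evalT (prodT n n) ⟧ (at n ψ)                       ≡⟨ test prodT-expansion (at n ψ) (at-vanishing n ψ ℕP.≤-refl) ⟩
    ⟦ one ++ Σ-eH n ⟧ (at n ψ)                           ≡⟨ ⟦⟧-++ one (Σ-eH n) (at n ψ) ⟩
    -- The constant 1 of the expansion has no tⁿ part because n is positive.
    + 0 ℤ.+ ⟦ Σ-eH n ⟧ (at n ψ)                          ≡⟨ ℤP.+-identityˡ _ ⟩
    ⟦ Σ-eH n ⟧ (at n ψ)                                  ≡⟨ ⟦Σ-eH⟧ n ⟩
    ∑ n (λ k → sgn k ℤ.* sumTo n (hits (suc k)))         ∎
    where open ≡.≡-Reasoning

-- Finite sums of integers

χ-× : ∀ {P Q : Set} (P? : Dec P) (Q? : Dec Q) → χ P? ℤ.* χ Q? ≡ χ (P? ×-dec Q?)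
χ-× (yes _) Q? = ℤP.*-identityˡ (χ Q?)
χ-× (no _)  Q? = refl

sumTo≡∑ : ∀ n f → sumTo n f ≡ ∑ (suc n) f
sumTo≡∑ zero    f = sym (ℤP.+-identityˡ (f 0))
sumTo≡∑ (suc n) f = cong (ℤ._+ f (suc n)) (sumTo≡∑ n f)

∑-cong : ∀ n {f g : ℕ → ℤ} → (∀ k → k < n → f k ≡ g k) → ∑ n f ≡ ∑ n g
∑-cong zero    eq = refl
∑-cong (suc n) eq = cong₂ ℤ._+_ (∑-cong n (λ k k<n → eq k (ℕP.m≤n⇒m≤1+n k<n))) (eq n ℕP.≤-refl)

∑-zero : ∀ n {f : ℕ → ℤ} → (∀ k → k < n → f k ≡ + 0) → ∑ n f ≡ + 0
∑-zero zero    eq = refl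
∑-zero (suc n) eq = cong₂ ℤ._+_ (∑-zero n (λ k k<n → eq k (ℕP.m≤n⇒m≤1+n k<n))) (eq n ℕP.≤-refl)

∑-+ : ∀ n (f g : ℕ → ℤ) → ∑ n (λ k → f k ℤ.+ g k) ≡ ∑ n f ℤ.+ ∑ n g
∑-+ zero    f g = refl
∑-+ (suc n) f g = trans (cong (ℤ._+ (f n ℤ.+ g n)) (∑-+ n f g))
  (solve 4 (λ a b c d → a :+ b :+ (c :+ d) := a :+ c :+ (b :+ d)) refl (∑ n f) (∑ n g) (f n) (g n))

∑-neg : ∀ n (f : ℕ → ℤ) → ∑ n (λ k → ℤ.- f k) ≡ ℤ.- ∑ n f
∑-neg zero    f = refl
∑-neg (suc n) f = trans (cong (ℤ._- f n) (∑-neg n f)) (sym (ℤP.neg-distrib-+ (∑ n f) (f n)))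

∑-swap : ∀ m n (f : ℕ → ℕ → ℤ) → ∑ m (λ j → ∑ n (f j)) ≡ ∑ n (λ k → ∑ m (λ j → f j k))
∑-swap zero    n f = sym (∑-zero n (λ _ _ → refl))
∑-swap (suc m) n f = trans (cong (ℤ._+ ∑ n (f m)) (∑-swap m n f)) (sym (∑-+ n (λ k → ∑ m (λ j → f j k)) (f m)))

∑-split : ∀ m n (f : ℕ → ℤ) → ∑ (m ℕ.+ n) f ≡ ∑ m f ℤ.+ ∑ n (λ k → f (m ℕ.+ k))
∑-split m zero    f rewrite ℕP.+-identityʳ m = sym (ℤP.+-identityʳ _)
∑-split m (suc n) f rewrite ℕP.+-suc m n =
  trans (cong (ℤ._+ f (m ℕ.+ n)) (∑-split m n f)) (ℤP.+-assoc (∑ m f) _ _)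

∑-drop : ∀ m n {f : ℕ → ℤ} → (∀ k → k < m → f k ≡ + 0) → ∑ (m ℕ.+ n) f ≡ ∑ n (λ k → f (m ℕ.+ k))
∑-drop m n {f} f≡0 = trans (∑-split m n f) (trans (cong (ℤ._+ ∑ n (λ k → f (m ℕ.+ k))) (∑-zero m f≡0)) (ℤP.+-identityˡ _))

∑-extend : ∀ {m n} {f : ℕ → ℤ} → m ≤ n → (∀ k → m ≤ k → f k ≡ + 0) → ∑ n f ≡ ∑ m f
∑-extend {m} {n} {f} m≤n f≡0 = begin
  ∑ n f                                             ≡⟨ cong (λ n → ∑ n f) (ℕP.m+[n∸m]≡n m≤n) ⟨
  ∑ (m ℕ.+ (n ∸ m)) f                               ≡⟨ ∑-split m (n ∸ m) f ⟩
  ∑ m f ℤ.+ ∑ (n ∸ m) (λ k → f (m ℕ.+ k))           ≡⟨ cong (λ s → ∑ m f ℤ.+ s) (∑-zero (n ∸ m) (λ k _ → f≡0 (m ℕ.+ k) (ℕP.m≤m+n m k))) ⟩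
  ∑ m f ℤ.+ + 0                                     ≡⟨ ℤP.+-identityʳ _ ⟩
  ∑ m f                                             ∎
  where open ≡.≡-Reasoning

∑-single : ∀ n {f : ℕ → ℤ} m → m < n → (∀ k → k ≢ m → f k ≡ + 0) → ∑ n f ≡ f m
∑-single n {f} m m<n f≡0 = begin
  ∑ n f             ≡⟨ ∑-extend m<n (λ k m<k → f≡0 k (λ k≡m → ℕP.<⇒≢ m<k (sym k≡m))) ⟩
  ∑ m f ℤ.+ f m     ≡⟨ cong (ℤ._+ f m) (∑-zero m (λ k k<m → f≡0 k (ℕP.<⇒≢ k<m))) ⟩
  + 0 ℤ.+ f m       ≡⟨ ℤP.+-identityˡ (f m) ⟩
  f m               ∎
  where open ≡.≡-Reasoning

∑-pairs : ∀ n (f : ℕ → ℤ) → ∑ (n ℕ.* 2) f ≡ ∑ n (λ k → f (k ℕ.* 2) ℤ.+ f (suc (k ℕ.* 2)))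
∑-pairs zero    f = refl
∑-pairs (suc n) f = trans (ℤP.+-assoc (∑ (n ℕ.* 2) f) _ _) (cong (ℤ._+ (f (n ℕ.* 2) ℤ.+ f (suc (n ℕ.* 2)))) (∑-pairs n f))

-- Triangular numbers, enumeration of divisors and linearised bounds

tri-even : ∀ f → tri (f ℕ.* 2) ≡ f ℕ.* suc (f ℕ.* 2)
tri-even zero    = refl
tri-even (suc f) rewrite tri-even f =
  identity f
  where
  identity : ∀ f → 2 ℕ.+ f ℕ.* 2 ℕ.+ (1 ℕ.+ f ℕ.* 2 ℕ.+ f ℕ.* (1 ℕ.+ f ℕ.* 2)) ≡ (1 ℕ.+ f) ℕ.* (3 ℕ.+ f ℕ.* 2)
  identity = solve-∀

tri-odd : ∀ f → tri (suc (f ℕ.* 2)) ≡ suc (f ℕ.* 2) ℕ.* suc f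
tri-odd f rewrite tri-even f =
  identity f
  where
  identity : ∀ f → 1 ℕ.+ f ℕ.* 2 ℕ.+ f ℕ.* (1 ℕ.+ f ℕ.* 2) ≡ (1 ℕ.+ f ℕ.* 2) ℕ.* (1 ℕ.+ f)
  identity = solve-∀

sgn-even : ∀ f → sgn (f ℕ.* 2) ≡ + 1
sgn-even zero    = refl
sgn-even (suc f) = trans (ℤP.neg-involutive (sgn (f ℕ.* 2))) (sgn-even f)

length-filter-upTo : ∀ {P : ℕ → Set} (P? : ∀ d → Dec (P d)) n →
  + length (filter P? (map suc (upTo n))) ≡ ∑ n (λ d → χ (P? (suc d)))
length-filter-upTo P? zero    = refl
length-filter-upTo P? (suc n) = begin
  + length (filter P? (map suc (upTo (suc n))))                          ≡⟨ cong (λ u → + length (filter P? (map suc u))) (ListP.upTo-∷ʳ n) ⟨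
  + length (filter P? (map suc (upTo n ∷ʳ n)))                           ≡⟨ cong (λ u → + length (filter P? u)) (ListP.map-++ suc (upTo n) (n ∷ [])) ⟩
  + length (filter P? (map suc (upTo n) ∷ʳ suc n))                       ≡⟨ cong (λ u → + length u) (ListP.filter-++ P? (map suc (upTo n)) (suc n ∷ [])) ⟩
  + length (filter P? (map suc (upTo n)) ++ filter P? (suc n ∷ []))      ≡⟨ cong +_ (ListP.length-++ (filter P? (map suc (upTo n)))) ⟩
  + length (filter P? (map suc (upTo n))) ℤ.+ + length (filter P? (suc n ∷ []))
                                                                         ≡⟨ cong₂ ℤ._+_ (length-filter-upTo P? n) last ⟩
  ∑ (suc n) (λ d → χ (P? (suc d)))                                       ∎
  where
  open ≡.≡-Reasoning
  last : + length (filter P? (suc n ∷ [])) ≡ χ (P? (suc n))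
  last with does (P? (suc n))
  ... | true  = refl
  ... | false = refl

-- The bounds d ≤ i + s and d > (i + s)/2 with s = √(2n + i²) both become linear
-- through (D - i)² - i² = D (D - 2i).
square-∸ : ∀ i y → (i ℕ.* 2 ℕ.+ y ∸ i) ℕ.* (i ℕ.* 2 ℕ.+ y ∸ i) ≡ y ℕ.* (i ℕ.* 2 ℕ.+ y) ℕ.+ i ℕ.* i
square-∸ i y = trans (cong (λ x → x ℕ.* x) D∸i)
  (square i y)
  where
  square : ∀ i y → (i ℕ.+ y) ℕ.* (i ℕ.+ y) ≡ y ℕ.* (i ℕ.* 2 ℕ.+ y) ℕ.+ i ℕ.* i
  square = solve-∀
  regroup : ∀ i y → i ℕ.* 2 ℕ.+ y ≡ i ℕ.+ (i ℕ.+ y)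
  regroup = solve-∀
  D∸i : i ℕ.* 2 ℕ.+ y ∸ i ≡ i ℕ.+ y
  D∸i = trans (cong (_∸ i) (regroup i y)) (ℕP.m+n∸m≡n i (i ℕ.+ y))

-- Serves both bounds. For n = c d, the lower one takes D = 2d with 2n = c (2d), and the upper one
-- takes D = d with 2n = (2c) d. If D < 2i, the truncated difference `D ∸ i` is at most i, so the
-- premise fails.
exceeds-root : ∀ c D i → 0 < D → c ℕ.* D ℕ.+ i ℕ.* i < (D ∸ i) ℕ.* (D ∸ i) → c ℕ.+ i ℕ.* 2 < D
exceeds-root c D i 0<D lt with i ℕ.* 2 ℕ.≤? D
... | yes 2i≤D with D ∸ i ℕ.* 2 | ℕP.m+[n∸m]≡n 2i≤D
...   | y | refl = ≡.subst (_< i ℕ.* 2 ℕ.+ y) (ℕP.+-comm (i ℕ.* 2) c) (ℕP.+-monoʳ-< (i ℕ.* 2)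
          (ℕP.*-cancelʳ-< (i ℕ.* 2 ℕ.+ y) c y (ℕP.+-cancelʳ-< (i ℕ.* i) _ _ (≡.subst (c ℕ.* (i ℕ.* 2 ℕ.+ y) ℕ.+ i ℕ.* i <_) (square-∸ i y) lt))))
exceeds-root c D i 0<D lt | no 2i≰D = contradiction lt (ℕP.≤⇒≯ (ℕP.≤-trans (ℕP.*-mono-≤ D∸i≤i D∸i≤i) (ℕP.m≤n+m (i ℕ.* i) (c ℕ.* D))))
  where
  D∸i≤i : D ∸ i ≤ i
  D∸i≤i = ℕP.m≤n+o⇒m∸n≤o D i (≡.subst (D ≤_) (trans (ℕP.*-comm i 2) (cong (i ℕ.+_) (ℕP.+-identityʳ i))) (ℕP.<⇒≤ (ℕP.≰⇒> 2i≰D)))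

exceeds-root⁻¹ : ∀ c D i → 0 < D → c ℕ.+ i ℕ.* 2 < D → c ℕ.* D ℕ.+ i ℕ.* i < (D ∸ i) ℕ.* (D ∸ i)
exceeds-root⁻¹ c D i 0<D lt with D ∸ i ℕ.* 2 | ℕP.m+[n∸m]≡n (ℕP.≤-trans (ℕP.m≤n+m (i ℕ.* 2) c) (ℕP.<⇒≤ lt))
... | y | refl = ≡.subst (c ℕ.* (i ℕ.* 2 ℕ.+ y) ℕ.+ i ℕ.* i <_) (sym (square-∸ i y)) (ℕP.+-monoˡ-< (i ℕ.* i)
      (ℕP.*-monoˡ-< (i ℕ.* 2 ℕ.+ y) {{ℕ.>-nonZero 0<D}} (ℕP.+-cancelˡ-< (i ℕ.* 2) c y (≡.subst (_< i ℕ.* 2 ℕ.+ y) (ℕP.+-comm c (i ℕ.* 2)) lt))))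

-- Matching the alternating sum with the divisor count

module Counting (n′ i : ℕ) where
  n = suc n′
  open Coefficient n′ i using (hits; coefficient-formula)

  β-term γ-term : ℕ → ℕ → ℤ
  β-term e d = χ ((e ℕ.* d ℕ.≟ n) ×-dec (e ℕ.+ i ℕ.* 2 ℕ.<? d ℕ.* 2))
  γ-term e d = χ ((e ℕ.* d ℕ.≟ n) ×-dec (e ℕ.* 2 ℕ.+ i ℕ.* 2 ℕ.<? d))

  α β γ : ℕ → ℤ
  α k = ∑ (suc n) (hits k)
  β e = ∑ (suc n) (β-term e)
  γ f = ∑ (suc n) (γ-term f)

  cofactor≤n : ∀ e d → suc e ℕ.* d ≡ n → d ≤ n
  cofactor≤n e d eq = ≡.subst (d ≤_) eq (ℕP.m≤m+n d (e ℕ.* d))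

  factor≤n : ∀ e d → e ℕ.* d ≡ n → e ≤ n
  factor≤n e zero    eq = contradiction (trans (sym (ℕP.*-zeroʳ e)) eq) λ ()
  factor≤n e (suc d) eq = ≡.subst (e ≤_) eq (ℕP.m≤m*n e (suc d))

  hits-χ : ∀ k j → hits k j ≡ χ ((tri k ℕ.+ k ℕ.* j ℕ.≟ n) ×-dec (i ℕ.≤? j))
  hits-χ k j = χ-× (tri k ℕ.+ k ℕ.* j ℕ.≟ n) (i ℕ.≤? j)

  -- For k = 2f+1 the triangular number is k (f+1), so the equation for j becomes k d = n with d =
  -- f+1+j. Then 2d = k+1+2j, which turns i ≤ j into k + 2i < 2d.
  α-odd : ∀ f → α (suc (f ℕ.* 2)) ≡ β (suc (f ℕ.* 2))
  α-odd f = sym (begin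
    -- The range is lengthened by f+1 so that n+1 values of j remain after the substitution. The
    -- added d exceed n and cannot divide it; the initial d ≤ f fail the inequality.
    β k                                        ≡⟨ ∑-extend (ℕP.m≤n+m (suc n) (suc f)) (λ d n<d → χ-false (term? d) (λ (eq , _) → ℕP.<⇒≱ n<d (cofactor≤n (f ℕ.* 2) d eq))) ⟨
    ∑ (suc f ℕ.+ suc n) (λ d → χ (term? d))    ≡⟨ ∑-drop (suc f) (suc n) (λ d d≤f → χ-false (term? d) (λ (_ , lt) → too-small d d≤f lt)) ⟩
    ∑ (suc n) (λ j → χ (term? (suc f ℕ.+ j)))  ≡⟨ ∑-cong (suc n) (λ j _ → trans (matches j) (sym (hits-χ k j))) ⟩
    α k                                        ∎)
    where
    open ≡.≡-Reasoning
    k = suc (f ℕ.* 2)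
    term? : ∀ d → Dec (k ℕ.* d ≡ n × k ℕ.+ i ℕ.* 2 < d ℕ.* 2)
    term? d = (k ℕ.* d ℕ.≟ n) ×-dec (k ℕ.+ i ℕ.* 2 ℕ.<? d ℕ.* 2)
    too-small : ∀ d → d < suc f → ¬ (k ℕ.+ i ℕ.* 2 < d ℕ.* 2)
    too-small d (s≤s d≤f) lt = ℕP.<⇒≱ lt (ℕP.≤-trans (ℕP.*-monoˡ-≤ 2 d≤f) (ℕP.≤-trans (ℕP.n≤1+n _) (ℕP.m≤m+n k (i ℕ.* 2))))
    product≡ : ∀ j → k ℕ.* (suc f ℕ.+ j) ≡ tri k ℕ.+ k ℕ.* j
    product≡ j = trans (ℕP.*-distribˡ-+ k (suc f) j) (cong (ℕ._+ k ℕ.* j) (sym (tri-odd f)))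
    double≡ : ∀ j → (suc f ℕ.+ j) ℕ.* 2 ≡ suc (k ℕ.+ j ℕ.* 2)
    double≡ j = cong (λ x → suc (suc x)) (ℕP.*-distribʳ-+ 2 f j)
    matches : ∀ j → χ (term? (suc f ℕ.+ j)) ≡ χ ((tri k ℕ.+ k ℕ.* j ℕ.≟ n) ×-dec (i ℕ.≤? j))
    matches j = χ-cong (term? (suc f ℕ.+ j)) ((tri k ℕ.+ k ℕ.* j ℕ.≟ n) ×-dec (i ℕ.≤? j))
      (λ (eq , lt) → trans (sym (product≡ j)) eq
                   , ℕP.*-cancelʳ-≤ i j 2 (ℕP.+-cancelˡ-≤ k _ _ (ℕP.≤-pred (≡.subst (k ℕ.+ i ℕ.* 2 <_) (double≡ j) lt))))
      (λ (eq , i≤j) → trans (product≡ j) eq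
                    , ≡.subst (k ℕ.+ i ℕ.* 2 <_) (sym (double≡ j)) (s≤s (ℕP.+-monoʳ-≤ k (ℕP.*-monoˡ-≤ 2 i≤j))))

  -- Parity of l: l = 2m gives the conditions of β at 2f. For l = 2(f+j)+1 one gets f l = f(2f+1) +
  -- 2f j, whose first summand is the triangular number of 2f, and the inequality becomes i ≤ j. Odd
  -- l below 2f fail the inequality.
  γ-split : ∀ f′ → γ (suc f′) ≡ β (suc f′ ℕ.* 2) ℤ.+ α (suc f′ ℕ.* 2)
  γ-split f′ = begin
    γ f                                                               ≡⟨ ∑-extend n<2L (λ l n<l → χ-false (term? l) (λ (eq , _) → ℕP.<⇒≱ n<l (cofactor≤n f′ l eq))) ⟨
    ∑ (L ℕ.* 2) (λ l → χ (term? l))                                   ≡⟨ ∑-pairs L _ ⟩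
    ∑ L (λ m → χ (term? (m ℕ.* 2)) ℤ.+ χ (term? (suc (m ℕ.* 2))))     ≡⟨ ∑-+ L _ _ ⟩
    ∑ L (λ m → χ (term? (m ℕ.* 2))) ℤ.+ ∑ L (λ m → χ (term? (suc (m ℕ.* 2)))) ≡⟨ cong₂ ℤ._+_ even odd ⟩
    β (f ℕ.* 2) ℤ.+ α (f ℕ.* 2)                                       ∎
    where
    open ≡.≡-Reasoning
    f = suc f′
    L = f ℕ.+ suc n
    n<2L : suc n ≤ L ℕ.* 2
    n<2L = ℕP.≤-trans (ℕP.m≤n+m (suc n) f) (ℕP.m≤m*n L 2)
    term? : ∀ l → Dec (f ℕ.* l ≡ n × f ℕ.* 2 ℕ.+ i ℕ.* 2 < l)
    term? l = (f ℕ.* l ℕ.≟ n) ×-dec (f ℕ.* 2 ℕ.+ i ℕ.* 2 ℕ.<? l)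
    β-term? : ∀ m → Dec (f ℕ.* 2 ℕ.* m ≡ n × f ℕ.* 2 ℕ.+ i ℕ.* 2 < m ℕ.* 2)
    β-term? m = (f ℕ.* 2 ℕ.* m ℕ.≟ n) ×-dec (f ℕ.* 2 ℕ.+ i ℕ.* 2 ℕ.<? m ℕ.* 2)
    swap2 : ∀ m → f ℕ.* (m ℕ.* 2) ≡ f ℕ.* 2 ℕ.* m
    swap2 m = trans (cong (f ℕ.*_) (ℕP.*-comm m 2)) (sym (ℕP.*-assoc f 2 m))
    even : ∑ L (λ m → χ (term? (m ℕ.* 2))) ≡ β (f ℕ.* 2)
    even = trans
      (∑-cong L (λ m _ → χ-cong (term? (m ℕ.* 2)) (β-term? m)
        (λ (eq , lt) → trans (sym (swap2 m)) eq , lt) (λ (eq , lt) → trans (swap2 m) eq , lt)))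
      (∑-extend (ℕP.m≤n+m (suc n) f) (λ m n<m → χ-false (β-term? m) (λ (eq , _) → ℕP.<⇒≱ n<m (cofactor≤n (suc (f′ ℕ.* 2)) m eq))))
    product≡ : ∀ j → f ℕ.* suc ((f ℕ.+ j) ℕ.* 2) ≡ tri (f ℕ.* 2) ℕ.+ f ℕ.* 2 ℕ.* j
    product≡ j = trans
      (regroup f j)
      (cong (ℕ._+ f ℕ.* 2 ℕ.* j) (sym (tri-even f)))
      where
      regroup : ∀ f j → f ℕ.* (1 ℕ.+ (f ℕ.+ j) ℕ.* 2) ≡ f ℕ.* (1 ℕ.+ f ℕ.* 2) ℕ.+ f ℕ.* 2 ℕ.* j
      regroup = solve-∀
    matches : ∀ j → χ (term? (suc ((f ℕ.+ j) ℕ.* 2))) ≡ χ ((tri (f ℕ.* 2) ℕ.+ f ℕ.* 2 ℕ.* j ℕ.≟ n) ×-dec (i ℕ.≤? j))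
    matches j = χ-cong (term? (suc ((f ℕ.+ j) ℕ.* 2))) ((tri (f ℕ.* 2) ℕ.+ f ℕ.* 2 ℕ.* j ℕ.≟ n) ×-dec (i ℕ.≤? j))
      (λ (eq , lt) → trans (sym (product≡ j)) eq
                   , ℕP.*-cancelʳ-≤ i j 2 (ℕP.+-cancelˡ-≤ (f ℕ.* 2) _ _ (≡.subst (f ℕ.* 2 ℕ.+ i ℕ.* 2 ≤_) (ℕP.*-distribʳ-+ 2 f j) (ℕP.≤-pred lt))))
      (λ (eq , i≤j) → trans (product≡ j) eq
                    , s≤s (≡.subst (f ℕ.* 2 ℕ.+ i ℕ.* 2 ≤_) (sym (ℕP.*-distribʳ-+ 2 f j)) (ℕP.+-monoʳ-≤ (f ℕ.* 2) (ℕP.*-monoˡ-≤ 2 i≤j))))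
    odd : ∑ L (λ m → χ (term? (suc (m ℕ.* 2)))) ≡ α (f ℕ.* 2)
    odd = trans
      (∑-drop f (suc n) (λ m m<f → χ-false (term? (suc (m ℕ.* 2)))
        (λ (_ , lt) → ℕP.<⇒≱ lt (ℕP.≤-trans (ℕP.*-monoˡ-< 2 m<f) (ℕP.m≤m+n (f ℕ.* 2) (i ℕ.* 2))))))
      (∑-cong (suc n) (λ j _ → trans (matches j) (sym (hits-χ (f ℕ.* 2) j))))

  α-vanishes : ∀ k → n ≤ k → α (suc k) ≡ + 0
  α-vanishes k n≤k = ∑-zero (suc n) (λ j _ → trans (hits-χ (suc k) j)
    (χ-false ((tri (suc k) ℕ.+ suc k ℕ.* j ℕ.≟ n) ×-dec (i ℕ.≤? j))
      (λ (eq , _) → ℕP.<⇒≱ (s≤s n≤k) (≡.subst (suc k ≤_) eq (ℕP.≤-trans (ℕP.m≤m+n (suc k) (tri k)) (ℕP.m≤m+n (tri (suc k)) (suc k ℕ.* j)))))))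

  β-vanishes : ∀ e → n ≤ e → β (suc e) ≡ + 0
  β-vanishes e n≤e = ∑-zero (suc n) (λ d _ → χ-false ((suc e ℕ.* d ℕ.≟ n) ×-dec (suc e ℕ.+ i ℕ.* 2 ℕ.<? d ℕ.* 2))
    (λ (eq , _) → ℕP.<⇒≱ (s≤s n≤e) (factor≤n (suc e) d eq)))

  alternating-α : ∑ n (λ k → sgn k ℤ.* α (suc k)) ≡ ∑ n (λ e → β (suc e)) ℤ.- ∑ n (λ f → γ (suc f))
  alternating-α = begin
    ∑ n (λ k → sgn k ℤ.* α (suc k))
      -- The range is doubled so that k splits evenly into odd and even indices; the added counts
      -- vanish.
      ≡⟨ ∑-extend (ℕP.m≤m*n n 2) (λ k n≤k → trans (cong (sgn k ℤ.*_) (α-vanishes k n≤k)) (ℤP.*-zeroʳ (sgn k))) ⟨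
    ∑ (n ℕ.* 2) (λ k → sgn k ℤ.* α (suc k))
      ≡⟨ ∑-pairs n _ ⟩
    ∑ n (λ f → sgn (f ℕ.* 2) ℤ.* α (suc (f ℕ.* 2)) ℤ.+ ℤ.- sgn (f ℕ.* 2) ℤ.* α (suc f ℕ.* 2))
      ≡⟨ ∑-cong n (λ f _ → pair f) ⟩
    ∑ n (λ f → β (suc (f ℕ.* 2)) ℤ.+ β (suc f ℕ.* 2) ℤ.- γ (suc f))
      ≡⟨ ∑-+ n _ _ ⟩
    ∑ n (λ f → β (suc (f ℕ.* 2)) ℤ.+ β (suc f ℕ.* 2)) ℤ.+ ∑ n (λ f → ℤ.- γ (suc f))
      ≡⟨ cong₂ ℤ._+_ (trans (sym (∑-pairs n (λ e → β (suc e)))) (∑-extend (ℕP.m≤m*n n 2) β-vanishes)) (∑-neg n (λ f → γ (suc f))) ⟩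
    ∑ n (λ e → β (suc e)) ℤ.- ∑ n (λ f → γ (suc f)) ∎
    where
    open ≡.≡-Reasoning
    pair : ∀ f → sgn (f ℕ.* 2) ℤ.* α (suc (f ℕ.* 2)) ℤ.+ ℤ.- sgn (f ℕ.* 2) ℤ.* α (suc f ℕ.* 2)
                 ≡ β (suc (f ℕ.* 2)) ℤ.+ β (suc f ℕ.* 2) ℤ.- γ (suc f)
    pair f = trans (cong₂ (λ s x → s ℤ.* x ℤ.+ ℤ.- s ℤ.* α (suc f ℕ.* 2)) (sgn-even f) (α-odd f))
      (trans (solve 3 (λ x y z → con (+ 1) :* x :+ :- con (+ 1) :* z := x :+ y :+ :- (y :+ z)) refl
               (β (suc (f ℕ.* 2))) (β (suc f ℕ.* 2)) (α (suc f ℕ.* 2)))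
             (cong (λ g → β (suc (f ℕ.* 2)) ℤ.+ β (suc f ℕ.* 2) ℤ.- g) (sym (γ-split f))))

  Lower-χ Upper-χ : ℕ → ℕ → ℤ
  Lower-χ c d = χ (c ℕ.+ i ℕ.* 2 ℕ.<? d ℕ.* 2)
  Upper-χ c d = χ (c ℕ.* 2 ℕ.+ i ℕ.* 2 ℕ.<? d)

  -- If the upper bound fails, 2c + 2i < d, then c + 2i < 2d and the lower bound holds. The failures
  -- are thus a subset, and the indicator of both bounds is a difference.
  good-χ-factor : ∀ c d → n ≡ c ℕ.* suc d → χ (good? n i (suc d)) ≡ Lower-χ c (suc d) ℤ.- Upper-χ c (suc d)
  good-χ-factor c d′ n≡cd = by-cases (c ℕ.+ i ℕ.* 2 ℕ.<? d ℕ.* 2) (c ℕ.* 2 ℕ.+ i ℕ.* 2 ℕ.<? d)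
    where
    d = suc d′
    2n≡c*2d : 2 ℕ.* n ≡ c ℕ.* (2 ℕ.* d)
    2n≡c*2d = trans (cong (2 ℕ.*_) n≡cd) (identity c d)
      where
      identity : ∀ c d → 2 ℕ.* (c ℕ.* d) ≡ c ℕ.* (2 ℕ.* d)
      identity = solve-∀
    2n≡2c*d : 2 ℕ.* n ≡ c ℕ.* 2 ℕ.* d
    2n≡2c*d = trans (cong (2 ℕ.*_) n≡cd) (identity c d)
      where
      identity : ∀ c d → 2 ℕ.* (c ℕ.* d) ≡ c ℕ.* 2 ℕ.* d
      identity = solve-∀
    lower : c ℕ.+ i ℕ.* 2 < d ℕ.* 2 → LowerOK n i d
    lower lt = ≡.subst (λ m → m ℕ.+ i ℕ.* i < (2 ℕ.* d ∸ i) ℕ.* (2 ℕ.* d ∸ i)) (sym 2n≡c*2d)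
      (exceeds-root⁻¹ c (2 ℕ.* d) i (s≤s z≤n) (≡.subst (c ℕ.+ i ℕ.* 2 <_) (ℕP.*-comm d 2) lt))
    lower⁻¹ : LowerOK n i d → c ℕ.+ i ℕ.* 2 < d ℕ.* 2
    lower⁻¹ ok = ≡.subst (c ℕ.+ i ℕ.* 2 <_) (ℕP.*-comm 2 d) (exceeds-root c (2 ℕ.* d) i (s≤s z≤n)
      (≡.subst (λ m → m ℕ.+ i ℕ.* i < (2 ℕ.* d ∸ i) ℕ.* (2 ℕ.* d ∸ i)) 2n≡c*2d ok))
    above : ℕ → Set
    above m = m ℕ.+ i ℕ.* i < (d ∸ i) ℕ.* (d ∸ i)
    not-upper : c ℕ.* 2 ℕ.+ i ℕ.* 2 < d → ¬ UpperOK n i d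
    not-upper lt = ℕP.<⇒≱ (≡.subst above (sym 2n≡2c*d) (exceeds-root⁻¹ (c ℕ.* 2) d i (s≤s z≤n) lt))
    upper : ¬ (c ℕ.* 2 ℕ.+ i ℕ.* 2 < d) → UpperOK n i d
    upper ≮ = ℕP.≮⇒≥ (λ lt → ≮ (exceeds-root (c ℕ.* 2) d i (s≤s z≤n) (≡.subst above 2n≡2c*d lt)))
    by-cases : (l : Dec (c ℕ.+ i ℕ.* 2 < d ℕ.* 2)) (u : Dec (c ℕ.* 2 ℕ.+ i ℕ.* 2 < d)) → χ (good? n i d) ≡ χ l ℤ.- χ u
    by-cases (yes l) (yes u) = χ-false (good? n i d) (λ (_ , _ , ok) → not-upper u ok)
    by-cases (yes l) (no ¬u) = χ-true (good? n i d) (divides c n≡cd , lower l , upper ¬u)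
    by-cases (no ¬l) (yes u) = contradiction (ℕP.≤-trans (s≤s (ℕP.+-monoˡ-≤ (i ℕ.* 2) (ℕP.m≤m*n c 2))) (ℕP.≤-trans u (ℕP.m≤m*n d 2))) ¬l
    by-cases (no ¬l) (no ¬u) = χ-false (good? n i d) (λ (_ , ok , _) → ¬l (lower⁻¹ ok))

  terms-off : ∀ e d → e ℕ.* d ≢ n → β-term e d ℤ.- γ-term e d ≡ + 0
  terms-off e d ed≢n = cong₂ ℤ._-_
    (χ-false ((e ℕ.* d ℕ.≟ n) ×-dec (e ℕ.+ i ℕ.* 2 ℕ.<? d ℕ.* 2)) (λ (eq , _) → ed≢n eq))
    (χ-false ((e ℕ.* d ℕ.≟ n) ×-dec (e ℕ.* 2 ℕ.+ i ℕ.* 2 ℕ.<? d)) (λ (eq , _) → ed≢n eq))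

  -- Only the cofactor e = n/d contributes. Leaving e as a summation variable allows the sums over d
  -- and e to be exchanged.
  good-χ : ∀ d → χ (good? n i (suc d)) ≡ ∑ n (λ e → β-term (suc e) (suc d) ℤ.- γ-term (suc e) (suc d))
  good-χ d′ with suc d′ ∣? n
  ... | no d∤n = trans (χ-false (good? n i (suc d′)) (λ (d∣n , _) → d∤n d∣n))
        (sym (∑-zero n (λ e _ → terms-off (suc e) (suc d′) (λ eq → d∤n (divides (suc e) (sym eq))))))
  ... | yes (divides zero ())
  ... | yes (divides (suc c′) n≡cd) = sym (begin
    ∑ n (λ e → β-term (suc e) d ℤ.- γ-term (suc e) d)
      ≡⟨ ∑-single n c′ (factor≤n c d (sym n≡cd)) (λ e e≢c′ → terms-off (suc e) d
           (λ eq → e≢c′ (ℕP.suc-injective (ℕP.*-cancelʳ-≡ (suc e) c d (trans eq n≡cd))))) ⟩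
    β-term c d ℤ.- γ-term c d
      ≡⟨ cong₂ ℤ._-_ (on (c ℕ.+ i ℕ.* 2 ℕ.<? d ℕ.* 2)) (on (c ℕ.* 2 ℕ.+ i ℕ.* 2 ℕ.<? d)) ⟩
    Lower-χ c d ℤ.- Upper-χ c d
      ≡⟨ good-χ-factor c d′ n≡cd ⟨
    χ (good? n i d) ∎)
    where
    open ≡.≡-Reasoning
    c = suc c′
    d = suc d′
    on : ∀ {P : Set} (P? : Dec P) → χ ((c ℕ.* d ℕ.≟ n) ×-dec P?) ≡ χ P?
    on P? = χ-cong ((c ℕ.* d ℕ.≟ n) ×-dec P?) P? proj₂ (λ p → sym n≡cd , p)

  count≡ : + countDivs n i ≡ ∑ n (λ e → β (suc e)) ℤ.- ∑ n (λ f → γ (suc f))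
  count≡ = begin
    + countDivs n i
      ≡⟨ length-filter-upTo (good? n i) n ⟩
    ∑ n (λ d → χ (good? n i (suc d)))
      ≡⟨ ∑-cong n (λ d _ → good-χ d) ⟩
    ∑ n (λ d → ∑ n (λ e → β-term (suc e) (suc d) ℤ.- γ-term (suc e) (suc d)))
      ≡⟨ ∑-swap n n _ ⟩
    ∑ n (λ e → ∑ n (λ d → β-term (suc e) (suc d) ℤ.- γ-term (suc e) (suc d)))
      ≡⟨ ∑-cong n (λ e _ → inner e) ⟩
    ∑ n (λ e → β (suc e) ℤ.- γ (suc e))
      ≡⟨ ∑-+ n _ _ ⟩
    ∑ n (λ e → β (suc e)) ℤ.+ ∑ n (λ e → ℤ.- γ (suc e))
      ≡⟨ cong (λ s → ∑ n (λ e → β (suc e)) ℤ.+ s) (∑-neg n _) ⟩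
    ∑ n (λ e → β (suc e)) ℤ.- ∑ n (λ f → γ (suc f)) ∎
    where
    open ≡.≡-Reasoning
    -- The divisors are enumerated from 1 whereas β starts at d = 0, where the strict inequality is
    -- impossible.
    β-tail : ∀ e → ∑ n (λ d → β-term e (suc d)) ≡ β e
    β-tail e = sym (∑-drop 1 n head)
      where
      head : ∀ d → d < 1 → β-term e d ≡ + 0
      head zero    _        = χ-false ((e ℕ.* 0 ℕ.≟ n) ×-dec (e ℕ.+ i ℕ.* 2 ℕ.<? 0)) (ℕP.n≮0 ∘ proj₂)
      head (suc _) (s≤s ())
    γ-tail : ∀ e → ∑ n (λ d → γ-term e (suc d)) ≡ γ e
    γ-tail e = sym (∑-drop 1 n head)
      where
      head : ∀ d → d < 1 → γ-term e d ≡ + 0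
      head zero    _        = χ-false ((e ℕ.* 0 ℕ.≟ n) ×-dec (e ℕ.* 2 ℕ.+ i ℕ.* 2 ℕ.<? 0)) (ℕP.n≮0 ∘ proj₂)
      head (suc _) (s≤s ())
    inner : ∀ e → ∑ n (λ d → β-term (suc e) (suc d) ℤ.- γ-term (suc e) (suc d)) ≡ β (suc e) ℤ.- γ (suc e)
    inner e = trans (∑-+ n _ _) (cong₂ ℤ._+_ (β-tail (suc e)) (trans (∑-neg n _) (cong ℤ.-_ (γ-tail (suc e)))))

  a≡countDivs : a n i ≡ + countDivs n i
  a≡countDivs = begin
    a n i                                               ≡⟨ coefficient-formula ⟩
    ∑ n (λ k → sgn k ℤ.* sumTo n (hits (suc k)))        ≡⟨ ∑-cong n (λ k _ → cong (sgn k ℤ.*_) (sumTo≡∑ n (hits (suc k)))) ⟩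
    ∑ n (λ k → sgn k ℤ.* α (suc k))                     ≡⟨ alternating-α ⟩
    ∑ n (λ e → β (suc e)) ℤ.- ∑ n (λ f → γ (suc f))     ≡⟨ count≡ ⟨
    + countDivs n i                                     ∎
    where open ≡.≡-Reasoning

theorem1p2 : (n i : ℕ) → 1 ≤ n → i < n → a n i ≡ + countDivs n i
theorem1p2 (suc n′) i _ _ = Counting.a≡countDivs n′ i
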